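{- Let $d$ be a natural number and $\alpha, \varepsilon$ positive real numbers satisfying $\alpha^{d(d-2)} \le \varepsilon < 1$. Let $G$ be a graph on $(1+\varepsilon)\alpha^{ -d} n$ vertices of density at least $\alpha$. Then $G$ is universal for the family of bipartite graphs $H$ on $n$ vertices which have a vertex partition $W_1 \cup W_2$ into two independent sets such that every vertex in $W_1$ has at most $d$ neighbors in $W_2$, and such that $\frac{|W_2|^d}{|W_2|(|W_2|-1) \cdots (|W_2|-d+1)} \le 1 + \varepsilon$.
   Context: The density of a graph is the fraction of pairs of distinct vertices that form an edge. A graph $G$ is universal for a family $\mathcal{F}$ of graphs if it contains every $F\in\mathcal{F}$ as a (not necessarily induced) subgraph. -}

module Defs where

open import Level using (0ℓ)
open import Data.Nat as ℕ using (ℕ; zero; suc; _∸_; _<ᵇ_; _^_)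
open import Data.Integer as ℤ using (ℤ; +_; -[1+_])
open import Data.Bool using (Bool; true; false; _∧_; if_then_else_)
open import Data.Fin using (Fin; toℕ)
open import Data.Product using (Σ; ∃; _×_; _,_)
open import Relation.Binary.PropositionalEquality using (_≡_; _≢_)
open import Relation.Binary.Structures using (IsTotalOrder)
open import Algebra.Structures using (IsCommutativeRing)
open import Function.Definitions using (Injective)

-- The real numbers, axiomatised as a complete ordered field.
-- (Any two models are isomorphic, so quantifying over all models is the
-- same as speaking about ℝ.)  Inverse is total with the convention
-- 0⁻¹ = 0; only x ≢ 0 → x * x⁻¹ ≡ 1 is assumed.

record RealField : Set₁ where
  infixl 6 _+_
  infixl 7 _*_
  infix 4 _≤_ _<_
  field
    ℝ    : Set
    _+_  : ℝ → ℝ → ℝ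
    _*_  : ℝ → ℝ → ℝ
    -_   : ℝ → ℝ
    0ℝ   : ℝ
    1ℝ   : ℝ
    _⁻¹  : ℝ → ℝ
    _≤_  : ℝ → ℝ → Set
    isCommutativeRing : IsCommutativeRing _≡_ _+_ _*_ -_ 0ℝ 1ℝ
    0≢1      : 0ℝ ≢ 1ℝ
    inverseʳ : ∀ x → x ≢ 0ℝ → x * (x ⁻¹) ≡ 1ℝ
    inv-zero : 0ℝ ⁻¹ ≡ 0ℝ
    isTotalOrder : IsTotalOrder _≡_ _≤_
    +-mono-≤ : ∀ x y z → x ≤ y → x + z ≤ y + z
    *-nonneg : ∀ x y → 0ℝ ≤ x → 0ℝ ≤ y → 0ℝ ≤ x * y
    complete : (P : ℝ → Set) → ∃ P → (∃ λ b → ∀ x → P x → x ≤ b) →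
               ∃ λ s → (∀ x → P x → x ≤ s) ×
                       (∀ b → (∀ x → P x → x ≤ b) → s ≤ b)

  _<_ : ℝ → ℝ → Set
  x < y = x ≤ y × x ≢ y

  _/_ : ℝ → ℝ → ℝ
  x / y = x * (y ⁻¹)

  fromℕ : ℕ → ℝ
  fromℕ zero    = 0ℝ
  fromℕ (suc n) = 1ℝ + fromℕ n

  _^ⁿ_ : ℝ → ℕ → ℝ
  x ^ⁿ zero  = 1ℝ
  x ^ⁿ suc k = x * (x ^ⁿ k)

  _^ᶻ_ : ℝ → ℤ → ℝ
  x ^ᶻ (+ k)     = x ^ⁿ k
  x ^ᶻ -[1+ k ]  = (x ^ⁿ suc k) ⁻¹

record Graph (n : ℕ) : Set where
  field
    adj   : Fin n → Fin n → Bool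
    sym   : ∀ i j → adj i j ≡ adj j i
    irrefl : ∀ i → adj i i ≡ false
open Graph public

count : ∀ {n} → (Fin n → Bool) → ℕ
count {zero}  p = 0
count {suc n} p = (if p Data.Fin.zero then 1 else 0) ℕ.+ count {n} (λ i → p (Data.Fin.suc i))

edges : ∀ {n} → Graph n → ℕ
edges {n} G = sumF (λ i → count (λ j → (toℕ i <ᵇ toℕ j) ∧ adj G i j))
  where
  sumF : ∀ {m} → (Fin m → ℕ) → ℕ
  sumF {zero}  f = 0
  sumF {suc m} f = f Data.Fin.zero ℕ.+ sumF (λ i → f (Data.Fin.suc i))

falling : ℕ → ℕ → ℕ
falling m zero    = 1
falling m (suc k) = falling m k ℕ.* (m ∸ k)

module _ (R : RealField) where
  open RealField R

  density : ∀ {N} → Graph N → ℝ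
  density {N} G = fromℕ (edges G) / fromℕ ((N ℕ.* (N ∸ 1)) ℕ./ 2)

_⊆G_ : ∀ {n N} → Graph n → Graph N → Set
_⊆G_ {n} {N} H G = Σ (Fin n → Fin N) λ f → Injective _≡_ _≡_ f ×
                     (∀ i j → adj H i j ≡ true → adj G (f i) (f j) ≡ true)

-- A bipartition W₁ ∪ W₂ given by side : Fin n → Bool (true = W₂),
-- both parts independent.
IndependentBipartition : ∀ {n} → Graph n → (Fin n → Bool) → Set
IndependentBipartition H side =
  ∀ i j → adj H i j ≡ true → side i ≡ side j → Data.Empty.⊥
  where import Data.Empty

W₁-degree≤ : ∀ {n} → Graph n → (Fin n → Bool) → ℕ → Set
W₁-degree≤ H side d =
  ∀ i → side i ≡ false →
    count (λ j → side j ∧ adj H i j) ℕ.≤ d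

sizeW₂ : ∀ {n} → (Fin n → Bool) → ℕ
sizeW₂ side = count side

module _ (R : RealField) where
  open RealField R

  InFamily : (d : ℕ) (ε : ℝ) {n : ℕ} → Graph n → Set
  InFamily d ε {n} H = Σ (Fin n → Bool) λ side →
    IndependentBipartition H side ×
    W₁-degree≤ H side d ×
    -- the ratio below is defined (nonzero denominator) iff d ≤ |W₂|
    d ℕ.≤ sizeW₂ side ×
    (fromℕ (sizeW₂ side ^ d) / fromℕ (falling (sizeW₂ side) d) ≤ 1ℝ + ε)

{-# OPTIONS --safe #-}

-- Pick a vertex x and embed W₂ into N(x) by a uniformly random injection φ.  If x is
-- weighted by about deg(x)^d, then for a d-subset of W₂ with image T the expectation of
-- 1/|N(T)| is at most (number of d-tuples) / Σ deg^d, which is of order 1/n.  Deleting the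
-- rest of φ(W₂) from N(T) costs only a factor close to 1/(1 - |W₂|/deg x), because the
-- deleted points form a random subset of N(x) and x itself is never deleted.  The slack
-- |W₂|/n between |W₁| and n pays for this factor, so that for some x and φ the reciprocals
-- of the sizes of the candidate sets N(φ(N(w))) ∖ φ(W₂), w ∈ W₁, sum to at most 1.  Then the
-- largest of any k candidate sets has at least k elements, and W₁ is embedded greedily.
-- Since α ≤ 1, the hypothesis α^{d(d-2)} ≤ ε < 1 only serves to force d ≥ 3.
module Submission where

open import Defs
open import Level using (0ℓ)
open import Data.Nat using (ℕ)
open import Data.Nat as ℕ using (zero; suc; _∸_)
import Data.Nat.Properties as ℕ
open import Data.Nat.Solver using (module +-*-Solver)
open import Data.Bool using (Bool; true; false; _∧_; not; if_then_else_)
open import Data.Bool.Properties using (∧-comm; ∧-assoc)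
open import Data.Fin using (Fin; zero; suc; punchIn; punchOut)
open import Data.Fin.Properties using (_≟_; punchIn-punchOut)
open import Data.Vec.Functional using (insertAt)
open import Data.Vec.Functional.Properties using (insertAt-lookup; insertAt-punchIn)
open import Data.Product using (∃; _×_; _,_; proj₁; proj₂)
open import Data.Sum using (_⊎_; inj₁; inj₂; [_,_]′)
open import Data.Empty using (⊥-elim)
open import Function using (_∘_)
open import Function.Definitions using (Injective)
open import Relation.Nullary using (¬_; Dec; does; yes; no)
open import Relation.Binary.Bundles using (Poset)
open import Relation.Binary.Structures using (IsTotalOrder)
open import Relation.Binary.PropositionalEquality as ≡
  using (_≡_; _≢_; refl; cong; cong₂; trans; subst; subst₂; _≗_)
open import Algebra.Bundles using (CommutativeRing)
import Algebra.Properties.Ring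
import Algebra.Properties.Semiring.Sum
import Algebra.Solver.Ring.NaturalCoefficients.Default as SemiringSolver
import Relation.Binary.Reasoning.PartialOrder

-- Deleting `φ(W₂)` costs about `D/(D - m)`, where `D` is the degree of `x` and `m = |W₂|`, so the
-- weight really used for `x` is `D^(d-1) (D - m)`. With `b = α(N-1)`, a lower bound on the mean
-- degree, its sum over all vertices is at least `(b - m) N b^(d-1)`. The deletion is affordable
-- because `|W₁|/n = 1 - m/n < 1 - m/b` once `n < b`. Two small losses come from having `α(N-1)`
-- instead of `αN`. For `d ≥ 3` the number of `d`-tuples is at most `(N-1)^d`, which matches `b^d`.
-- The ratio condition gives `ε(m-1) ≥ 1`, which is what makes `n < b` hold. Since `0⁻¹ = 0`, a
-- bounded sum of reciprocals does not exclude empty candidate sets. The vertex `x` does: it is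
-- adjacent to everything in `N(x)` and lies outside it, so it remains in every candidate set.

module Counting where
  open import Data.Nat using (_+_; _*_; _^_; _≤_; _<_; z≤n; s≤s; _<ᵇ_; _≤?_)
  open import Data.Nat.Properties hiding (_≟_)
  open import Data.Nat.DivMod using (m*n/n≡m)
  open import Data.Bool.Properties using (∧-zeroʳ; ∧-identityʳ)
  open import Data.Fin using (toℕ)
  open import Data.Fin.Properties using (toℕ-injective)
  open import Data.Empty using (⊥)
  open import Relation.Nullary.Decidable using (dec-true; dec-false)
  open import Algebra.Properties.Semiring.Sum +-*-semiring using (sum; sum-cong-≗; ∑-comm; ∑-distrib-+)

  -- Subsets of `Fin n` as Boolean predicates, and their sizes.

  Pred : ℕ → Set
  Pred n = Fin n → Bool

  infixl 7 _∖_ _∩_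

  _∖_ : ∀ {n} → Pred n → Fin n → Pred n
  (p ∖ v) i = p i ∧ not (does (i ≟ v))

  _∩_ : ∀ {n} → Pred n → Pred n → Pred n
  (p ∩ q) i = p i ∧ q i

  ∧-true⁻ : ∀ a {b} → a ∧ b ≡ true → a ≡ true × b ≡ true
  ∧-true⁻ true h = refl , h

  ∧-true⁺ : ∀ {a b} → a ≡ true → b ≡ true → a ∧ b ≡ true
  ∧-true⁺ refl refl = refl

  true≢false : ∀ {b} → b ≡ true → b ≡ false → ⊥
  true≢false refl ()

  ∖-intro : ∀ {n} (p : Pred n) {v i} → p i ≡ true → i ≢ v → (p ∖ v) i ≡ true
  ∖-intro p {v} {i} pi i≢v = ∧-true⁺ pi (cong not (dec-false (i ≟ v) i≢v))

  ∖-elim : ∀ {n} (p : Pred n) v {i} → (p ∖ v) i ≡ true → p i ≡ true × i ≢ v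
  ∖-elim p v {i} h with ∧-true⁻ (p i) h
  ... | pi , i≉v = pi , λ { refl → true≢false i≉v (cong not (dec-true (i ≟ i) refl)) }

  count-cong : ∀ {n} {p q : Pred n} → p ≗ q → count p ≡ count q
  count-cong {zero}  p≗q = refl
  count-cong {suc n} p≗q =
    cong₂ _+_ (cong (if_then 1 else 0) (p≗q zero)) (count-cong (p≗q ∘ suc))

  count≡sum : ∀ {n} (p : Pred n) → count p ≡ sum (λ i → if p i then 1 else 0)
  count≡sum {zero}  p = refl
  count≡sum {suc n} p = cong ((if p zero then 1 else 0) +_) (count≡sum (p ∘ suc))

  count-none : ∀ {n} (p : Pred n) → (∀ i → p i ≡ false) → count p ≡ 0
  count-none {zero}  p none = refl
  count-none {suc n} p none rewrite none zero = count-none (p ∘ suc) (none ∘ suc)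

  count-all : ∀ n → count {n} (λ _ → true) ≡ n
  count-all zero    = refl
  count-all (suc n) = cong suc (count-all n)

  count-not : ∀ {n} (p : Pred n) → count p + count (not ∘ p) ≡ n
  count-not {zero}  p = refl
  count-not {suc n} p with p zero
  ... | true  = cong suc (count-not (p ∘ suc))
  ... | false = trans (+-suc _ _) (cong suc (count-not (p ∘ suc)))

  count≤n : ∀ {n} (p : Pred n) → count p ≤ n
  count≤n p = subst (count p ≤_) (count-not p) (m≤m+n _ _)

  count-mono-≤ : ∀ {n} (p q : Pred n) → (∀ i → p i ≡ true → q i ≡ true) → count p ≤ count q
  count-mono-≤ {zero}  p q p⊆q = z≤n
  count-mono-≤ {suc n} p q p⊆q with p zero in p0 | q zero in q0
  ... | true  | true  = s≤s (count-mono-≤ (p ∘ suc) (q ∘ suc) (p⊆q ∘ suc))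
  ... | true  | false = ⊥-elim (true≢false (p⊆q zero p0) q0)
  ... | false | true  = m≤n⇒m≤1+n (count-mono-≤ (p ∘ suc) (q ∘ suc) (p⊆q ∘ suc))
  ... | false | false = count-mono-≤ (p ∘ suc) (q ∘ suc) (p⊆q ∘ suc)

  ∖-zero : ∀ {n} (p : Pred (suc n)) → (p ∖ zero) ∘ suc ≗ p ∘ suc
  ∖-zero p i = ∧-identityʳ (p (suc i))

  ∖-zero-suc : ∀ {n} (p : Pred (suc n)) v → (p ∖ suc v) zero ≡ p zero
  ∖-zero-suc p v = ∧-identityʳ (p zero)

  count-∖ : ∀ {n} (p : Pred n) v → p v ≡ true → count p ≡ suc (count (p ∖ v))
  count-∖ p zero pv
    rewrite pv | count-cong (∖-zero p) = refl
  count-∖ p (suc v) pv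
    rewrite ∖-zero-suc p v | count-∖ (p ∘ suc) v pv = +-suc _ _

  ∖-absent : ∀ {n} (p : Pred n) v → p v ≡ false → p ∖ v ≗ p
  ∖-absent p v pv i with i ≟ v
  ... | yes refl = trans (∧-zeroʳ (p i)) (≡.sym pv)
  ... | no _     = ∧-identityʳ (p i)

  count≤1+count-∖ : ∀ {n} (p : Pred n) v → count p ≤ suc (count (p ∖ v))
  count≤1+count-∖ p v with p v in pv
  ... | true  = ≤-reflexive (count-∖ p v pv)
  ... | false = ≤-trans (≤-reflexive (≡.sym (count-cong (∖-absent p v pv)))) (n≤1+n _)

  count-positive : ∀ {n} (p : Pred n) v → p v ≡ true → 0 < count p
  count-positive p v pv rewrite count-∖ p v pv = s≤s z≤n

  count-witness : ∀ {n} (p : Pred n) → 0 < count p → ∃ λ i → p i ≡ true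
  count-witness {suc n} p 0<c with p zero in p0
  ... | true  = zero , p0
  ... | false with count-witness (p ∘ suc) 0<c
  ...   | i , pi = suc i , pi

  -- Pigeonhole: each of the `k` values of `ψ` removes at most one element of `p`, so one survives.
  fresh : ∀ k {n} (ψ : Fin k → Fin n) (p : Pred n) → k < count p →
          ∃ λ y → p y ≡ true × (∀ i → ψ i ≢ y)
  fresh zero    ψ p k<c with count-witness p k<c
  ... | y , py = y , py , λ ()
  fresh (suc k) ψ p k<c
    with fresh k (ψ ∘ suc) (p ∖ ψ zero)
               (≤-pred (≤-trans k<c (count≤1+count-∖ p (ψ zero))))
  ... | y , p∖y , ψ≢y with ∖-elim p (ψ zero) p∖y
  ...   | py , y≢ψ0 = y , py , λ { zero → y≢ψ0 ∘ ≡.sym ; (suc i) → ψ≢y i }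

  -- Identifies a part of the bipartition with an initial segment of the naturals; `count-elem`
  -- carries the degree bound of `H` over to the new indices.
  record Enumeration {n} (p : Pred n) (m : ℕ) : Set where
    field
      elem       : Fin m → Fin n
      rank       : ∀ i → p i ≡ true → Fin m
      elem-rank  : ∀ i pi → elem (rank i pi) ≡ i
      elem-in    : ∀ a → p (elem a) ≡ true
      count-elem : ∀ q → count (q ∘ elem) ≡ count (p ∩ q)

    rank-injective : ∀ {i j} pi pj → rank i pi ≡ rank j pj → i ≡ j
    rank-injective {i} {j} pi pj eq =
      trans (≡.sym (elem-rank i pi)) (trans (cong elem eq) (elem-rank j pj))

  enumerate : ∀ {n} (p : Pred n) → Enumeration p (count p)
  enumerate {zero} p = record
    { elem = λ () ; rank = λ () ; elem-rank = λ () ; elem-in = λ () ; count-elem = λ _ → refl }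
  enumerate {suc n} p with p zero in p0 | enumerate (p ∘ suc)
  ... | true | E = record
    { elem       = λ { zero → zero ; (suc a) → suc (elem a) }
    ; rank       = λ { zero _ → zero ; (suc i) pi → suc (rank i pi) }
    ; elem-rank  = λ { zero _ → refl ; (suc i) pi → cong suc (elem-rank i pi) }
    ; elem-in    = λ { zero → p0 ; (suc a) → elem-in a }
    ; count-elem = λ q → cong₂ (λ b c → (if b ∧ q zero then 1 else 0) + c)
                               (≡.sym p0) (count-elem (q ∘ suc))
    }
    where open Enumeration E
  ... | false | E = record
    { elem       = suc ∘ elem
    ; rank       = λ { zero p0′ → ⊥-elim (true≢false p0′ p0) ; (suc i) pi → rank i pi }
    ; elem-rank  = λ { zero p0′ → ⊥-elim (true≢false p0′ p0) ; (suc i) pi → cong suc (elem-rank i pi) }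
    ; elem-in    = elem-in
    ; count-elem = λ q → cong₂ (λ b c → (if b ∧ q zero then 1 else 0) + c)
                               (≡.sym p0) (count-elem (q ∘ suc))
    }
    where open Enumeration E

  cons : ∀ {n} {A : Set} → A → (Fin n → A) → Fin (suc n) → A
  cons a f zero    = a
  cons a f (suc i) = f i

  -- Pads a neighbourhood in `W₂` to exactly `d` elements, so that all vertices of `W₁` have the
  -- same initial potential.
  extend : ∀ {m} (p : Pred m) d → count p ≤ d → d ≤ m →
           ∃ λ q → count q ≡ d × (∀ i → p i ≡ true → q i ≡ true)
  extend {zero}  p zero c≤d d≤m = p , refl , λ _ pi → pi
  extend {suc m} p d c≤d d≤m with p zero in p0 | d ≤? m
  extend {suc m} p (suc d) (s≤s c≤d) (s≤s d≤m) | true | _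
    with extend (p ∘ suc) d c≤d d≤m
  ... | q , cq , p⊆q = cons true q , cong suc cq , λ { zero _ → refl ; (suc i) → p⊆q i }
  extend {suc m} p d c≤d d≤m | false | yes d≤m′ with extend (p ∘ suc) d c≤d d≤m′
  ... | q , cq , p⊆q = cons false q , cq ,
                       λ { zero p0′ → ⊥-elim (true≢false p0′ p0) ; (suc i) → p⊆q i }
  extend {suc m} p d c≤d d≤m | false | no d≰m =
    (λ _ → true) , trans (count-all (suc m)) (≤-antisym (≰⇒> d≰m) d≤m) , λ _ _ → refl

  -- Degrees, edges and pairs.

  deg : ∀ {n} → Graph n → Fin n → ℕ
  deg G x = count (adj G x)

  -- The local summation inside edges has no name outside Defs; the underscore
  -- is solved to it by the use of sumF-sum in edges≡sum.
  mutual
    sumF-sum : ∀ {k} (G : Graph k) m (g : Fin m → ℕ) → _ ≡ sum g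

    edges≡sum : ∀ {n} (G : Graph n) →
                edges G ≡ sum (λ i → count (λ j → (toℕ i <ᵇ toℕ j) ∧ adj G i j))
    edges≡sum {zero}  G = refl
    edges≡sum {suc n} G
      -- Abstracting the head, the summand and the size leaves distinct variables as arguments of
      -- `sumF-sum`, so that its underscore is found by pattern unification.
      with count {suc n} (λ j → (0 <ᵇ toℕ j) ∧ adj G zero j)
         | (λ i → count (λ j → (toℕ (Fin.suc {n} i) <ᵇ toℕ j) ∧ adj G (suc i) j))
    ... | c | g with suc n
    ...   | k = cong (c +_) (sumF-sum G n g)

    sumF-sum G zero    g = refl
    sumF-sum G (suc m) g = cong (g zero +_) (sumF-sum G m (g ∘ suc))

  <ᵇ-trichotomy : ∀ a b → a ≢ b →
    ((a <ᵇ b) ≡ true × (b <ᵇ a) ≡ false) ⊎ ((a <ᵇ b) ≡ false × (b <ᵇ a) ≡ true)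
  <ᵇ-trichotomy zero    zero    a≢b = ⊥-elim (a≢b refl)
  <ᵇ-trichotomy zero    (suc b) a≢b = inj₁ (refl , refl)
  <ᵇ-trichotomy (suc a) zero    a≢b = inj₂ (refl , refl)
  <ᵇ-trichotomy (suc a) (suc b) a≢b = <ᵇ-trichotomy a b (a≢b ∘ cong suc)

  -- An ordered adjacent pair is increasing in exactly one of its two orders, and exchanging the
  -- names of `i` and `j` shows that both orders contribute `edges G`.
  handshake : ∀ {n} (G : Graph n) → sum (deg G) ≡ edges G + edges G
  handshake G = begin
    sum (deg G)
      ≡⟨ sum-cong-≗ (λ i → trans (count≡sum (adj G i)) (sum-cong-≗ (split i))) ⟩
    sum (λ i → sum (λ j → E i j + E j i))
      ≡⟨ sum-cong-≗ (λ i → ∑-distrib-+ (E i) (λ j → E j i)) ⟩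
    sum (λ i → sum (E i) + sum (λ j → E j i))
      ≡⟨ ∑-distrib-+ (λ i → sum (E i)) _ ⟩
    sum (λ i → sum (E i)) + sum (λ i → sum (λ j → E j i))
      ≡⟨ cong (sum (λ i → sum (E i)) +_) (∑-comm (λ i j → E j i)) ⟩
    sum (λ i → sum (E i)) + sum (λ i → sum (E i))
      ≡⟨ cong₂ _+_ E≡edges E≡edges ⟩
    edges G + edges G ∎
    where
    open ≡.≡-Reasoning
    E : ∀ i j → ℕ
    E i j = if (toℕ i <ᵇ toℕ j) ∧ adj G i j then 1 else 0
    E≡edges : sum (λ i → sum (E i)) ≡ edges G
    E≡edges = ≡.sym (trans (edges≡sum G) (sum-cong-≗ λ i → count≡sum λ j → (toℕ i <ᵇ toℕ j) ∧ adj G i j))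
    split : ∀ i j → (if adj G i j then 1 else 0) ≡ E i j + E j i
    split i j with adj G i j in ij | adj G j i in ji
    ... | true  | false = ⊥-elim (true≢false ij (trans (Graph.sym G i j) ji))
    ... | false | true  = ⊥-elim (true≢false ji (trans (Graph.sym G j i) ij))
    ... | false | false rewrite ∧-zeroʳ (toℕ i <ᵇ toℕ j) | ∧-zeroʳ (toℕ j <ᵇ toℕ i) = refl
    ... | true  | true
      with <ᵇ-trichotomy (toℕ i) (toℕ j)
             (λ eq → true≢false ij (subst (λ k → adj G i k ≡ false) (toℕ-injective eq) (irrefl G i)))
    ...   | inj₁ (i<j , j≮i) rewrite i<j | j≮i = refl
    ...   | inj₂ (i≮j , j<i) rewrite i≮j | j<i = refl

  deg<n : ∀ {n} (G : Graph n) x → deg G x < n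
  deg<n {n} G x = subst (deg G x <_) (count-not (adj G x))
    (m<m+n _ (count-positive _ x (cong not (irrefl G x))))

  sum-≤ : ∀ {n} (f : Fin n → ℕ) b → (∀ i → f i ≤ b) → sum f ≤ n * b
  sum-≤ {zero}  f b f≤b = z≤n
  sum-≤ {suc n} f b f≤b = +-mono-≤ (f≤b zero) (sum-≤ (f ∘ suc) b (f≤b ∘ suc))

  edges-upper : ∀ {n} (G : Graph n) → edges G + edges G ≤ n * (n ∸ 1)
  edges-upper {n} G = subst (_≤ n * (n ∸ 1)) (handshake G) (sum-≤ (deg G) _ λ x → ≤-pred′ (deg<n G x))
    where
    ≤-pred′ : ∀ {a b} → a < b → a ≤ b ∸ 1
    ≤-pred′ (s≤s a≤b) = a≤b

  pairs : ℕ → ℕ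
  pairs n = (n * (n ∸ 1)) ℕ./ 2

  -- The division in `density` is exact, a product of consecutive numbers being even.
  pairs+pairs : ∀ n → pairs n + pairs n ≡ n * (n ∸ 1)
  pairs+pairs n with even n
    where
    even : ∀ n → ∃ λ q → n * (n ∸ 1) ≡ q * 2
    even zero    = 0 , refl
    even (suc zero) = 0 , refl
    even (suc (suc n)) with even (suc n)
    ... | q , eq = q + suc n ,
      trans (solve 1 (λ n → (con 2 :+ n) :* (con 1 :+ n) := (con 1 :+ n) :* n :+ (con 1 :+ n) :* con 2) refl n)
            (trans (cong (_+ suc n * 2) eq) (≡.sym (*-distribʳ-+ 2 q (suc n))))
      where open +-*-Solver
  ... | q , eq rewrite eq | m*n/n≡m q 2 ⦃ _ ⦄ = solve 1 (λ q → q :+ q := q :* con 2) refl q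
    where open +-*-Solver

  -- Falling factorials.

  falling-suc : ∀ m t → falling (suc m) (suc t) ≡ suc m * falling m t
  falling-suc m zero    = trans (*-identityˡ _) (≡.sym (*-identityʳ _))
  falling-suc m (suc t) =
    trans (cong (_* (m ∸ t)) (falling-suc m t)) (*-assoc (suc m) (falling m t) (m ∸ t))

  falling-∸1 : ∀ m t → m * falling (m ∸ 1) t ≡ falling m (suc t)
  falling-∸1 zero    zero    = refl
  falling-∸1 zero    (suc t) = ≡.sym (*-zeroʳ (falling 0 (suc t)))
  falling-∸1 (suc m) t       = ≡.sym (falling-suc m t)

  falling-positive : ∀ m t → t ≤ m → 0 < falling m t
  falling-positive m zero    t≤m = s≤s z≤n
  falling-positive m (suc t) t<m =
    *-mono-≤ (falling-positive m t (<⇒≤ t<m)) (m<n⇒0<n∸m t<m)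

  -- The first three factors satisfy `(m+1) m (m-1) = m³ - m ≤ m³`, and each later one is at most
  -- `m`. Two factors would not suffice, since `(m+1) m > m²` for positive `m`.
  falling≤pred^ : ∀ m {d} → 3 ≤ d → falling (suc m) d ≤ m ^ d
  falling≤pred^ zero    {suc (suc (suc zero))} (s≤s (s≤s (s≤s _))) = z≤n
  falling≤pred^ (suc m) {suc (suc (suc zero))} (s≤s (s≤s (s≤s _))) = m+n≤o⇒m≤o _ (≤-reflexive
    (solve 1 (λ m → con 1 :* (con 2 :+ m) :* (con 1 :+ m) :* m :+ (con 1 :+ m)
                 := (con 1 :+ m) :* ((con 1 :+ m) :* ((con 1 :+ m) :* con 1))) refl m))
    where open +-*-Solver
  falling≤pred^ m {suc (suc (suc (suc j)))} (s≤s (s≤s (s≤s _))) =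
    ≤-trans (*-mono-≤ (falling≤pred^ m {suc (suc (suc j))} (s≤s (s≤s (s≤s z≤n)))) (m∸n≤m m (2 + j)))
            (≤-reflexive (*-comm (m ^ (3 + j)) m))

  -- Only the second factor is kept sharp. This is enough to extract `1 ≤ ε(m-1)` from the ratio
  -- condition.
  falling≤^*pred : ∀ m {e} → 1 ≤ e → falling m (suc e) ≤ m ^ e * (m ∸ 1)
  falling≤^*pred m {suc zero} (s≤s _) = ≤-reflexive (cong (_* (m ∸ 1)) (*-comm 1 m))
  falling≤^*pred m {suc (suc e)} (s≤s _) =
    ≤-trans (*-mono-≤ (falling≤^*pred m {suc e} (s≤s z≤n)) (m∸n≤m m (2 + e))) (≤-reflexive
      (solve 3 (λ m p q → m :* p :* q :* m := m :* (m :* p) :* q) refl m (m ^ e) (m ∸ 1)))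
    where open +-*-Solver

  -- Cross-multiplied form of the fact that `D^j / falling D j` decreases in `D`; it moves the ratio
  -- condition from `|W₂|` to the degree of the centre.
  falling-ratio : ∀ {m D} j → m ≤ D → D ^ j * falling m j ≤ m ^ j * falling D j
  falling-ratio zero m≤D = ≤-refl
  falling-ratio {m} {D} (suc j) m≤D = begin
    D * D ^ j * (falling m j * (m ∸ j))    ≡⟨ interchange D (D ^ j) (falling m j) (m ∸ j) ⟩
    (D ^ j * falling m j) * (D * (m ∸ j))  ≤⟨ *-mono-≤ (falling-ratio j m≤D) step ⟩
    (m ^ j * falling D j) * (m * (D ∸ j))  ≡⟨ interchange m (m ^ j) (falling D j) (D ∸ j) ⟨
    m * m ^ j * (falling D j * (D ∸ j))    ∎
    where
    open ≤-Reasoning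
    interchange : ∀ a b c d → a * b * (c * d) ≡ (b * c) * (a * d)
    interchange = solve 4 (λ a b c d → a :* b :* (c :* d) := (b :* c) :* (a :* d)) refl
      where open +-*-Solver
    step : D * (m ∸ j) ≤ m * (D ∸ j)
    step rewrite *-distribˡ-∸ D m j | *-distribˡ-∸ m D j | *-comm D m =
      ∸-monoʳ-≤ (m * D) (*-monoˡ-≤ j m≤D)

open Counting

-- Arithmetic of the ordered field.

module OrderedField (R : RealField) where
  open RealField R public hiding (+-mono-≤)

  commutativeRing : CommutativeRing 0ℓ 0ℓ
  commutativeRing = record { isCommutativeRing = isCommutativeRing }

  open CommutativeRing commutativeRing public
    using ( +-comm; +-assoc; +-identityˡ; +-identityʳ; -‿inverseˡ; -‿inverseʳ
          ; *-comm; *-assoc; *-identityˡ; *-identityʳ; distribˡ; distribʳ; zeroˡ; zeroʳ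
          ; ring; semiring; commutativeSemiring )
  open Algebra.Properties.Ring ring public using (-‿distribˡ-*; -‿involutive)
  open Algebra.Properties.Semiring.Sum semiring public
    using (sum; sum-cong-≗; sum-remove; ∑-comm; ∑-distrib-+; *-distribˡ-sum; *-distribʳ-sum; sum-replicate-zero)
  open SemiringSolver commutativeSemiring public using (solve; _:=_; _:+_; _:*_; con)

  open IsTotalOrder isTotalOrder public using () renaming
    (refl to ≤-refl; reflexive to ≤-reflexive; trans to ≤-trans; antisym to ≤-antisym; total to ≤-total)

  poset : Poset 0ℓ 0ℓ 0ℓ
  poset = record { isPartialOrder = IsTotalOrder.isPartialOrder isTotalOrder }

  module ≤-Reasoning = Relation.Binary.Reasoning.PartialOrder poset

  <⇒≱ : ∀ {a b} → a < b → ¬ (b ≤ a)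
  <⇒≱ (a≤b , a≢b) b≤a = a≢b (≤-antisym a≤b b≤a)

  <-≤-trans : ∀ {a b c} → a < b → b ≤ c → a < c
  <-≤-trans a<b b≤c = ≤-trans (proj₁ a<b) b≤c , λ { refl → <⇒≱ a<b b≤c }

  +-monoˡ-≤ : ∀ {a b} c → a ≤ b → a + c ≤ b + c
  +-monoˡ-≤ c a≤b = RealField.+-mono-≤ R _ _ c a≤b

  +-monoʳ-≤ : ∀ {a b} c → a ≤ b → c + a ≤ c + b
  +-monoʳ-≤ c a≤b = subst₂ _≤_ (+-comm _ c) (+-comm _ c) (+-monoˡ-≤ c a≤b)

  +-mono-≤ : ∀ {a b c d} → a ≤ b → c ≤ d → a + c ≤ b + d
  +-mono-≤ a≤b c≤d = ≤-trans (+-monoˡ-≤ _ a≤b) (+-monoʳ-≤ _ c≤d)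

  +-inverse-cancel : ∀ a c → (a + c) + - c ≡ a
  +-inverse-cancel a c =
    trans (+-assoc a c (- c)) (trans (cong (a +_) (-‿inverseʳ c)) (+-identityʳ a))

  +-cancelʳ-≤ : ∀ {a b} c → a + c ≤ b + c → a ≤ b
  +-cancelʳ-≤ c h = subst₂ _≤_ (+-inverse-cancel _ c) (+-inverse-cancel _ c) (+-monoˡ-≤ (- c) h)

  +-cancelˡ-≤ : ∀ {a b} c → c + a ≤ c + b → a ≤ b
  +-cancelˡ-≤ c h = +-cancelʳ-≤ c (subst₂ _≤_ (+-comm c _) (+-comm c _) h)

  +-cancelʳ-≡ : ∀ {a b} c → a + c ≡ b + c → a ≡ b
  +-cancelʳ-≡ c h =
    trans (≡.sym (+-inverse-cancel _ c)) (trans (cong (_+ - c) h) (+-inverse-cancel _ c))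

  +-cancelʳ-< : ∀ {a b} c → a + c < b + c → a < b
  +-cancelʳ-< c (h , ne) = +-cancelʳ-≤ c h , λ { refl → ne refl }

  +-monoʳ-< : ∀ {a b} c → a < b → c + a < c + b
  +-monoʳ-< c (a≤b , a≢b) = +-monoʳ-≤ c a≤b ,
    λ eq → a≢b (+-cancelʳ-≡ c (trans (+-comm _ c) (trans eq (+-comm c _))))

  *-monoˡ-≤ : ∀ {a b} c → 0ℝ ≤ c → a ≤ b → c * a ≤ c * b
  *-monoˡ-≤ {a} {b} c 0≤c a≤b = subst₂ _≤_ (+-identityˡ (c * a)) c[b-a]+ca≡cb
    (+-monoˡ-≤ (c * a) (*-nonneg c (b + - a) 0≤c 0≤b-a))
    where
    0≤b-a : 0ℝ ≤ b + - a
    0≤b-a = subst (_≤ b + - a) (-‿inverseʳ a) (+-monoˡ-≤ (- a) a≤b)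
    c[b-a]+ca≡cb : c * (b + - a) + c * a ≡ c * b
    c[b-a]+ca≡cb = trans (≡.sym (distribˡ c _ a)) (cong (c *_)
      (trans (+-assoc b (- a) a) (trans (cong (b +_) (-‿inverseˡ a)) (+-identityʳ b))))

  *-monoʳ-≤ : ∀ {a b} c → 0ℝ ≤ c → a ≤ b → a * c ≤ b * c
  *-monoʳ-≤ c 0≤c a≤b = subst₂ _≤_ (*-comm c _) (*-comm c _) (*-monoˡ-≤ c 0≤c a≤b)

  *-mono-≤ : ∀ {a b c d} → 0ℝ ≤ b → 0ℝ ≤ c → a ≤ b → c ≤ d → a * c ≤ b * d
  *-mono-≤ {b = b} {c} 0≤b 0≤c a≤b c≤d = ≤-trans (*-monoʳ-≤ c 0≤c a≤b) (*-monoˡ-≤ b 0≤b c≤d)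

  0≤1 : 0ℝ ≤ 1ℝ
  0≤1 with ≤-total 0ℝ 1ℝ
  ... | inj₁ h = h
  ... | inj₂ 1≤0 = subst (0ℝ ≤_) -1*-1≡1 (*-nonneg (- 1ℝ) (- 1ℝ) 0≤-1 0≤-1)
    where
    0≤-1 : 0ℝ ≤ - 1ℝ
    0≤-1 = subst₂ _≤_ (-‿inverseʳ 1ℝ) (+-identityˡ (- 1ℝ)) (+-monoˡ-≤ (- 1ℝ) 1≤0)
    -1*-1≡1 : - 1ℝ * - 1ℝ ≡ 1ℝ
    -1*-1≡1 = trans (≡.sym (-‿distribˡ-* 1ℝ (- 1ℝ)))
                    (trans (cong -_ (*-identityˡ (- 1ℝ))) (-‿involutive 1ℝ))

  0<1 : 0ℝ < 1ℝ
  0<1 = 0≤1 , 0≢1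

  *-inverseʳ : ∀ {c} → 0ℝ < c → c * c ⁻¹ ≡ 1ℝ
  *-inverseʳ (_ , 0≢c) = inverseʳ _ (λ c≡0 → 0≢c (≡.sym c≡0))

  *-inverseˡ : ∀ {c} → 0ℝ < c → c ⁻¹ * c ≡ 1ℝ
  *-inverseˡ 0<c = trans (*-comm _ _) (*-inverseʳ 0<c)

  ⁻¹-nonneg : ∀ {c} → 0ℝ < c → 0ℝ ≤ c ⁻¹
  ⁻¹-nonneg {c} 0<c with ≤-total 0ℝ (c ⁻¹)
  ... | inj₁ h = h
  ... | inj₂ c⁻¹≤0 = ⊥-elim (<⇒≱ 0<1
    (subst₂ _≤_ (*-inverseʳ 0<c) (zeroʳ c) (*-monoˡ-≤ c (proj₁ 0<c) c⁻¹≤0)))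

  ⁻¹-*-cancel : ∀ {c} a → 0ℝ < c → c ⁻¹ * (c * a) ≡ a
  ⁻¹-*-cancel {c} a 0<c =
    trans (≡.sym (*-assoc (c ⁻¹) c a)) (trans (cong (_* a) (*-inverseˡ 0<c)) (*-identityˡ a))

  /-*-cancel : ∀ {c} a → 0ℝ < c → a / c * c ≡ a
  /-*-cancel {c} a 0<c =
    trans (*-assoc a _ c) (trans (cong (a *_) (*-inverseˡ 0<c)) (*-identityʳ a))

  *-cancelˡ-≤ : ∀ {a b} c → 0ℝ < c → c * a ≤ c * b → a ≤ b
  *-cancelˡ-≤ c 0<c h = subst₂ _≤_ (⁻¹-*-cancel _ 0<c) (⁻¹-*-cancel _ 0<c)
    (*-monoˡ-≤ (c ⁻¹) (⁻¹-nonneg 0<c) h)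

  *-cancelˡ-≡ : ∀ {a b} c → 0ℝ < c → c * a ≡ c * b → a ≡ b
  *-cancelˡ-≡ c 0<c h =
    trans (≡.sym (⁻¹-*-cancel _ 0<c)) (trans (cong (c ⁻¹ *_) h) (⁻¹-*-cancel _ 0<c))

  *-cancelʳ-≤ : ∀ {a b} c → 0ℝ < c → a * c ≤ b * c → a ≤ b
  *-cancelʳ-≤ c 0<c h = *-cancelˡ-≤ c 0<c (subst₂ _≤_ (*-comm _ c) (*-comm _ c) h)

  *-monoˡ-< : ∀ {a b} c → 0ℝ < c → a < b → c * a < c * b
  *-monoˡ-< c 0<c (a≤b , a≢b) = *-monoˡ-≤ c (proj₁ 0<c) a≤b , λ eq → a≢b (*-cancelˡ-≡ c 0<c eq)

  *-cancelˡ-< : ∀ {a b} c → 0ℝ < c → c * a < c * b → a < b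
  *-cancelˡ-< c 0<c (h , ne) = *-cancelˡ-≤ c 0<c h , λ { refl → ne refl }

  *-positive : ∀ {a b} → 0ℝ < a → 0ℝ < b → 0ℝ < a * b
  *-positive {a} 0<a 0<b = subst (_< a * _) (zeroʳ a) (*-monoˡ-< a 0<a 0<b)

  ⁻¹-antitone : ∀ {a b} → 0ℝ < a → 0ℝ < b → a ⁻¹ ≤ b ⁻¹ → b ≤ a
  ⁻¹-antitone {a} {b} 0<a 0<b h = subst₂ _≤_
    (trans (cong (b *_) (*-inverseʳ 0<a)) (*-identityʳ b))
    (trans (*-comm b _) (trans (*-assoc a _ b) (trans (cong (a *_) (*-inverseˡ 0<b)) (*-identityʳ a))))
    (*-monoˡ-≤ b (proj₁ 0<b) (*-monoˡ-≤ a (proj₁ 0<a) h))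

  ≤-/⁻ : ∀ {a b c} → 0ℝ < c → a ≤ b / c → a * c ≤ b
  ≤-/⁻ {a} {b} {c} 0<c h = subst (a * c ≤_) (/-*-cancel b 0<c) (*-monoʳ-≤ c (proj₁ 0<c) h)

  /-≤⁻ : ∀ {a b c} → 0ℝ < c → a / c ≤ b → a ≤ b * c
  /-≤⁻ {a} {b} {c} 0<c h = subst (_≤ b * c) (/-*-cancel a 0<c) (*-monoʳ-≤ c (proj₁ 0<c) h)

  ^-nonneg : ∀ {a} k → 0ℝ ≤ a → 0ℝ ≤ a ^ⁿ k
  ^-nonneg zero    0≤a = 0≤1
  ^-nonneg (suc k) 0≤a = *-nonneg _ _ 0≤a (^-nonneg k 0≤a)

  ^-positive : ∀ {a} k → 0ℝ < a → 0ℝ < a ^ⁿ k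
  ^-positive zero    0<a = 0<1
  ^-positive (suc k) 0<a = *-positive 0<a (^-positive k 0<a)

  ^-monoˡ-≤ : ∀ {a b} k → 0ℝ ≤ a → a ≤ b → a ^ⁿ k ≤ b ^ⁿ k
  ^-monoˡ-≤ zero    0≤a a≤b = ≤-refl
  ^-monoˡ-≤ (suc k) 0≤a a≤b =
    *-mono-≤ (≤-trans 0≤a a≤b) (^-nonneg k 0≤a) a≤b (^-monoˡ-≤ k 0≤a a≤b)

  ^≤1 : ∀ {a} k → 0ℝ ≤ a → a ≤ 1ℝ → a ^ⁿ k ≤ 1ℝ
  ^≤1 zero    0≤a a≤1 = ≤-refl
  ^≤1 {a} (suc k) 0≤a a≤1 =
    subst (a * a ^ⁿ k ≤_) (*-identityˡ 1ℝ) (*-mono-≤ 0≤1 (^-nonneg k 0≤a) a≤1 (^≤1 k 0≤a a≤1))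

  ^-distrib-* : ∀ a b k → (a * b) ^ⁿ k ≡ a ^ⁿ k * b ^ⁿ k
  ^-distrib-* a b zero    = ≡.sym (*-identityˡ 1ℝ)
  ^-distrib-* a b (suc k) = trans (cong (a * b *_) (^-distrib-* a b k))
    (solve 4 (λ a b x y → a :* b :* (x :* y) := a :* x :* (b :* y)) refl a b (a ^ⁿ k) (b ^ⁿ k))

  fromℕ-+ : ∀ a b → fromℕ (a ℕ.+ b) ≡ fromℕ a + fromℕ b
  fromℕ-+ zero    b = ≡.sym (+-identityˡ _)
  fromℕ-+ (suc a) b = trans (cong (1ℝ +_) (fromℕ-+ a b)) (≡.sym (+-assoc 1ℝ _ _))

  fromℕ-* : ∀ a b → fromℕ (a ℕ.* b) ≡ fromℕ a * fromℕ b
  fromℕ-* zero    b = ≡.sym (zeroˡ _)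
  fromℕ-* (suc a) b = trans (fromℕ-+ b (a ℕ.* b)) (trans (cong (fromℕ b +_) (fromℕ-* a b))
    (solve 2 (λ x y → y :+ x :* y := (con 1 :+ x) :* y) refl (fromℕ a) (fromℕ b)))

  fromℕ-^ : ∀ a k → fromℕ (a ℕ.^ k) ≡ fromℕ a ^ⁿ k
  fromℕ-^ a zero    = +-identityʳ 1ℝ
  fromℕ-^ a (suc k) = trans (fromℕ-* a (a ℕ.^ k)) (cong (fromℕ a *_) (fromℕ-^ a k))

  fromℕ-nonneg : ∀ a → 0ℝ ≤ fromℕ a
  fromℕ-nonneg zero    = ≤-refl
  fromℕ-nonneg (suc a) =
    subst (_≤ fromℕ (suc a)) (+-identityˡ 0ℝ) (+-mono-≤ 0≤1 (fromℕ-nonneg a))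

  fromℕ-positive : ∀ {a} → 0 ℕ.< a → 0ℝ < fromℕ a
  fromℕ-positive {suc a} _ = <-≤-trans 0<1
    (subst (_≤ fromℕ (suc a)) (+-identityʳ 1ℝ) (+-monoʳ-≤ 1ℝ (fromℕ-nonneg a)))

  fromℕ-mono-≤ : ∀ {a b} → a ℕ.≤ b → fromℕ a ≤ fromℕ b
  fromℕ-mono-≤ {b = b} ℕ.z≤n = fromℕ-nonneg b
  fromℕ-mono-≤ (ℕ.s≤s a≤b) = +-monoʳ-≤ 1ℝ (fromℕ-mono-≤ a≤b)

  fromℕ-mono-< : ∀ {a b} → a ℕ.< b → fromℕ a < fromℕ b
  fromℕ-mono-< {a} a<b = <-≤-trans
    (subst₂ _<_ (+-identityʳ (fromℕ a)) (+-comm (fromℕ a) 1ℝ) (+-monoʳ-< (fromℕ a) 0<1))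
    (fromℕ-mono-≤ a<b)

  fromℕ-cancel-≤ : ∀ {a b} → fromℕ a ≤ fromℕ b → a ℕ.≤ b
  fromℕ-cancel-≤ {a} {b} h with ℕ.≤-total a b
  ... | inj₁ a≤b = a≤b
  ... | inj₂ b≤a with ℕ.m≤n⇒m<n∨m≡n b≤a
  ...   | inj₁ b<a  = ⊥-elim (<⇒≱ (fromℕ-mono-< b<a) h)
  ...   | inj₂ refl = ℕ.≤-refl

  frac-* : ∀ a b a′ b′ c → 0 ℕ.< b → 0 ℕ.< b′ → c ℕ.* a ℕ.* b′ ≡ a′ ℕ.* b →
           fromℕ c * (fromℕ a / fromℕ b) ≡ fromℕ a′ / fromℕ b′
  frac-* a b a′ b′ c 0<b 0<b′ eq = begin
    fc * (fa * fb ⁻¹)                    ≡⟨ solve 3 (λ x y z → x :* (y :* z) := x :* y :* con 1 :* z) refl fc fa (fb ⁻¹) ⟩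
    fc * fa * 1ℝ * fb ⁻¹                 ≡⟨ cong (λ u → fc * fa * u * fb ⁻¹) (≡.sym (*-inverseʳ 0<fb′)) ⟩
    fc * fa * (fb′ * fb′ ⁻¹) * fb ⁻¹      ≡⟨ solve 5 (λ x y z w v → x :* y :* (z :* w) :* v := x :* y :* z :* w :* v) refl fc fa fb′ (fb′ ⁻¹) (fb ⁻¹) ⟩
    fc * fa * fb′ * fb′ ⁻¹ * fb ⁻¹        ≡⟨ cong (λ u → u * fb′ ⁻¹ * fb ⁻¹) cross ⟩
    fa′ * fb * fb′ ⁻¹ * fb ⁻¹             ≡⟨ solve 4 (λ x y z w → x :* y :* z :* w := x :* z :* (y :* w)) refl fa′ fb (fb′ ⁻¹) (fb ⁻¹) ⟩
    fa′ * fb′ ⁻¹ * (fb * fb ⁻¹)           ≡⟨ cong (fa′ * fb′ ⁻¹ *_) (*-inverseʳ (fromℕ-positive 0<b)) ⟩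
    fa′ * fb′ ⁻¹ * 1ℝ                     ≡⟨ *-identityʳ _ ⟩
    fa′ * fb′ ⁻¹                          ∎
    where
    open ≡.≡-Reasoning
    fa  = fromℕ a
    fb  = fromℕ b
    fc  = fromℕ c
    fa′ = fromℕ a′
    fb′ = fromℕ b′
    0<fb′ = fromℕ-positive 0<b′
    cross : fc * fa * fb′ ≡ fa′ * fb
    cross = trans (trans (cong (_* fb′) (≡.sym (fromℕ-* c a))) (≡.sym (fromℕ-* (c ℕ.* a) b′)))
                  (trans (cong fromℕ eq) (fromℕ-* a′ b))

  -- Indicators, finite sums and averaging.

  𝟙 : Bool → ℝ
  𝟙 b = if b then 1ℝ else 0ℝ

  𝟙-∧ : ∀ a b → 𝟙 (a ∧ b) ≡ 𝟙 a * 𝟙 b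
  𝟙-∧ true  b = ≡.sym (*-identityˡ _)
  𝟙-∧ false b = ≡.sym (zeroˡ _)

  𝟙-nonneg : ∀ b → 0ℝ ≤ 𝟙 b
  𝟙-nonneg true  = 0≤1
  𝟙-nonneg false = ≤-refl

  fromℕ-count : ∀ {n} (p : Pred n) → fromℕ (count p) ≡ sum (𝟙 ∘ p)
  fromℕ-count {zero}  p = refl
  fromℕ-count {suc n} p with p zero
  ... | true  = cong (1ℝ +_) (fromℕ-count (p ∘ suc))
  ... | false = trans (fromℕ-count (p ∘ suc)) (≡.sym (+-identityˡ _))

  sum-mono-≤ : ∀ {n} {f g : Fin n → ℝ} → (∀ i → f i ≤ g i) → sum f ≤ sum g
  sum-mono-≤ {zero}  f≤g = ≤-refl
  sum-mono-≤ {suc n} f≤g = +-mono-≤ (f≤g zero) (sum-mono-≤ (f≤g ∘ suc))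

  sum-nonneg : ∀ {n} {f : Fin n → ℝ} → (∀ i → 0ℝ ≤ f i) → 0ℝ ≤ sum f
  sum-nonneg {n} {f} 0≤f = subst (_≤ sum f) (sum-replicate-zero n) (sum-mono-≤ 0≤f)

  sum-const : ∀ n c → sum {n} (λ _ → c) ≡ fromℕ n * c
  sum-const zero    c = ≡.sym (zeroˡ c)
  sum-const (suc n) c = trans (cong (c +_) (sum-const n c))
    (solve 2 (λ x c → c :+ x :* c := (con 1 :+ x) :* c) refl (fromℕ n) c)

  restricted-mono-≤ : ∀ {n} (p : Pred n) {f g : Fin n → ℝ} → (∀ i → p i ≡ true → f i ≤ g i) →
                      sum (λ i → 𝟙 (p i) * f i) ≤ sum (λ i → 𝟙 (p i) * g i)
  restricted-mono-≤ p {f} {g} f≤g = sum-mono-≤ λ i → lemma i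
    where
    lemma : ∀ i → 𝟙 (p i) * f i ≤ 𝟙 (p i) * g i
    lemma i with p i in pi
    ... | true  = *-monoˡ-≤ 1ℝ 0≤1 (f≤g i pi)
    ... | false = ≤-reflexive (trans (zeroˡ _) (≡.sym (zeroˡ _)))

  restricted-const : ∀ {n} (p : Pred n) c → sum (λ i → 𝟙 (p i) * c) ≡ fromℕ (count p) * c
  restricted-const p c =
    trans (≡.sym (*-distribʳ-sum c (𝟙 ∘ p))) (cong (_* c) (≡.sym (fromℕ-count p)))

  -- Strict inequality of reals is not decidable, so a good index is not always
  -- exhibited; the second alternative is refuted separately in each application.
  pick : ∀ {n} (good : Pred n) (f g : Fin n → ℝ) → sum f ≤ sum g →
         (∀ i → good i ≡ false → g i ≤ f i) →
         (∃ λ i → good i ≡ true × f i ≤ g i) ⊎ (sum g ≤ sum f × (∀ i → good i ≡ false))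
  pick {zero}  good f g f≤g bad = inj₂ (f≤g , λ ())
  pick {suc n} good f g f≤g bad with good zero in g0 | ≤-total (f zero) (g zero)
  ... | true | inj₁ f0≤g0 = inj₁ (zero , g0 , f0≤g0)
  ... | true | inj₂ g0≤f0
    with pick (good ∘ suc) (f ∘ suc) (g ∘ suc)
           (+-cancelˡ-≤ (f zero) (≤-trans f≤g (+-monoˡ-≤ _ g0≤f0))) (bad ∘ suc)
  ...   | inj₁ (i , gi , fi≤gi) = inj₁ (suc i , gi , fi≤gi)
  ...   | inj₂ (Σg≤Σf , _) =
    inj₁ (zero , g0 , +-cancelʳ-≤ _ (≤-trans f≤g (+-monoʳ-≤ (g zero) Σg≤Σf)))
  pick {suc n} good f g f≤g bad | false | _
    with pick (good ∘ suc) (f ∘ suc) (g ∘ suc)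
           (+-cancelˡ-≤ (f zero) (≤-trans f≤g (+-monoˡ-≤ _ (bad zero g0)))) (bad ∘ suc)
  ...   | inj₁ (i , gi , fi≤gi) = inj₁ (suc i , gi , fi≤gi)
  ...   | inj₂ (Σg≤Σf , none) =
    inj₂ (+-mono-≤ (bad zero g0) Σg≤Σf , λ { zero → g0 ; (suc i) → none i })

-- The reciprocal potential and the placement of `W₂`.

∖-swap-∈ : ∀ {n} (A : Pred n) u v → A v ∧ (A ∖ v) u ≡ A u ∧ (A ∖ u) v
∖-swap-∈ A u v with u ≟ v | v ≟ u
... | yes refl | yes _   = refl
... | yes refl | no u≢u  = ⊥-elim (u≢u refl)
... | no u≢u   | yes refl = ⊥-elim (u≢u refl)
... | no _     | no _ with A u | A v
...   | true  | true  = refl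
...   | true  | false = refl
...   | false | true  = refl
...   | false | false = refl

∧-swapʳ : ∀ a b c → (a ∧ b) ∧ c ≡ (a ∧ c) ∧ b
∧-swapʳ true  b c = ∧-comm b c
∧-swapʳ false b c = refl

open +-*-Solver using () renaming (solve to ℕ-solve; _:*_ to _⊗_; _:=_ to _⊜_)

module Potential (R : RealField) {N : ℕ} (G : Graph N) where
  open OrderedField R

  E : Fin N → Pred N
  E = adj G

  -- The sum of 1/|Q ∩ N(T)| over the injective t-tuples T in A.
  U : Pred N → Pred N → ℕ → ℝ
  U A Q zero    = fromℕ (count Q) ⁻¹
  U A Q (suc t) = sum λ v → 𝟙 (A v) * U (A ∖ v) (Q ∩ E v) t

  U-cong : ∀ t {A A′ Q Q′} → A ≗ A′ → Q ≗ Q′ → U A Q t ≡ U A′ Q′ t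
  U-cong zero    A≗A′ Q≗Q′ = cong (λ c → fromℕ c ⁻¹) (count-cong Q≗Q′)
  U-cong (suc t) A≗A′ Q≗Q′ = sum-cong-≗ λ v → cong₂ _*_ (cong 𝟙 (A≗A′ v))
    (U-cong t (λ i → cong (_∧ _) (A≗A′ i)) (λ i → cong (_∧ E v i) (Q≗Q′ i)))

  fromℕ⁻¹-nonneg : ∀ c → 0ℝ ≤ fromℕ c ⁻¹
  fromℕ⁻¹-nonneg zero    = ≤-reflexive (≡.sym inv-zero)
  fromℕ⁻¹-nonneg (suc c) = ⁻¹-nonneg (fromℕ-positive {suc c} (ℕ.s≤s ℕ.z≤n))

  -- Only an inequality, because the convention for the inverse makes the product 0 at `c = 0`.
  fromℕ*⁻¹≤1 : ∀ c → fromℕ c * fromℕ c ⁻¹ ≤ 1ℝ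
  fromℕ*⁻¹≤1 zero    = subst (_≤ 1ℝ) (≡.sym (zeroˡ _)) 0≤1
  fromℕ*⁻¹≤1 (suc c) = ≤-reflexive (*-inverseʳ (fromℕ-positive {suc c} (ℕ.s≤s ℕ.z≤n)))

  U-nonneg : ∀ t A Q → 0ℝ ≤ U A Q t
  U-nonneg zero    A Q = fromℕ⁻¹-nonneg (count Q)
  U-nonneg (suc t) A Q = sum-nonneg λ v → *-nonneg _ _ (𝟙-nonneg (A v)) (U-nonneg t _ _)

  -- `U` chooses the first entry of a tuple outermost. Exchanging it with a further choice brings
  -- that choice next to the shorter tuple, where induction applies.
  sum-swap : ∀ {k l} (a : Pred k) (b : Fin k → Pred l) (c : Pred l) (d : Fin l → Pred k)
             (X : Fin k → Fin l → ℝ) (Y : Fin l → Fin k → ℝ) →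
             (∀ v u → a v ∧ b v u ≡ c u ∧ d u v) → (∀ v u → X v u ≡ Y u v) →
             sum (λ v → 𝟙 (a v) * sum (λ u → 𝟙 (b v u) * X v u)) ≡
             sum (λ u → 𝟙 (c u) * sum (λ v → 𝟙 (d u v) * Y u v))
  sum-swap a b c d X Y ab≡cd X≡Y = begin
    sum (λ v → 𝟙 (a v) * sum (λ u → 𝟙 (b v u) * X v u))
      ≡⟨ sum-cong-≗ (λ v → *-distribˡ-sum (𝟙 (a v)) (λ u → 𝟙 (b v u) * X v u)) ⟩
    sum (λ v → sum (λ u → 𝟙 (a v) * (𝟙 (b v u) * X v u)))
      ≡⟨ ∑-comm (λ v u → 𝟙 (a v) * (𝟙 (b v u) * X v u)) ⟩
    sum (λ u → sum (λ v → 𝟙 (a v) * (𝟙 (b v u) * X v u)))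
      ≡⟨ sum-cong-≗ (λ u → sum-cong-≗ (λ v → term v u)) ⟩
    sum (λ u → sum (λ v → 𝟙 (c u) * (𝟙 (d u v) * Y u v)))
      ≡⟨ sum-cong-≗ (λ u → *-distribˡ-sum (𝟙 (c u)) (λ v → 𝟙 (d u v) * Y u v)) ⟨
    sum (λ u → 𝟙 (c u) * sum (λ v → 𝟙 (d u v) * Y u v)) ∎
    where
    open ≡.≡-Reasoning
    term : ∀ v u → 𝟙 (a v) * (𝟙 (b v u) * X v u) ≡ 𝟙 (c u) * (𝟙 (d u v) * Y u v)
    term v u = trans (merge (a v) (b v u) (X v u))
      (trans (cong₂ (λ z w → 𝟙 z * w) (ab≡cd v u) (X≡Y v u)) (≡.sym (merge (c u) (d u v) (Y u v))))
      where
      merge : ∀ p q x → 𝟙 p * (𝟙 q * x) ≡ 𝟙 (p ∧ q) * x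
      merge p q x = trans (≡.sym (*-assoc (𝟙 p) (𝟙 q) x)) (cong (_* x) (≡.sym (𝟙-∧ p q)))

  ∉-adjacent : ∀ {A : Pred N} {x} → (∀ v → A v ≡ true → E v x ≡ true) → ∀ {v} → A v ≡ true → v ≢ x
  ∉-adjacent A⊆Nx Av refl = true≢false (A⊆Nx _ Av) (irrefl G _)

  ⁻¹-split : ∀ {p} → 0 ℕ.< p →
             fromℕ p ⁻¹ ≡ fromℕ (suc p) ⁻¹ + fromℕ p ⁻¹ * fromℕ (suc p) ⁻¹
  ⁻¹-split {p} 0<p = ≡.sym (begin
    q⁻¹ + p⁻¹ * q⁻¹
      ≡⟨ solve 2 (λ p⁻¹ q⁻¹ → q⁻¹ :+ p⁻¹ :* q⁻¹ := con 1 :* q⁻¹ :+ p⁻¹ :* q⁻¹) refl p⁻¹ q⁻¹ ⟩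
    1ℝ * q⁻¹ + p⁻¹ * q⁻¹
      ≡⟨ cong (λ u → u * q⁻¹ + p⁻¹ * q⁻¹) (*-inverseˡ (fromℕ-positive 0<p)) ⟨
    p⁻¹ * fromℕ p * q⁻¹ + p⁻¹ * q⁻¹
      ≡⟨ solve 3 (λ p⁻¹ p q⁻¹ → p⁻¹ :* p :* q⁻¹ :+ p⁻¹ :* q⁻¹ := p⁻¹ :* ((con 1 :+ p) :* q⁻¹)) refl p⁻¹ (fromℕ p) q⁻¹ ⟩
    p⁻¹ * (fromℕ (suc p) * q⁻¹)
      ≡⟨ cong (p⁻¹ *_) (*-inverseʳ (fromℕ-positive {suc p} (ℕ.s≤s ℕ.z≤n))) ⟩
    p⁻¹ * 1ℝ
      ≡⟨ *-identityʳ p⁻¹ ⟩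
    p⁻¹ ∎)
    where
    open ≡.≡-Reasoning
    p⁻¹ = fromℕ p ⁻¹
    q⁻¹ = fromℕ (suc p) ⁻¹

  -- With |Q| = p + 1, hitting Q costs 1/p = 1/(p+1) + 1/(p (p+1)), and at most p
  -- elements of A lie in Q since x does not.
  U-remove₀ : ∀ A Q x → Q x ≡ true → (∀ v → A v ≡ true → E v x ≡ true) →
              sum (λ v → 𝟙 (A v) * fromℕ (count (Q ∖ v)) ⁻¹) ≤
              fromℕ (suc (count A)) * fromℕ (count Q) ⁻¹
  U-remove₀ A Q x Qx A⊆Nx = begin
    sum (λ v → 𝟙 (A v) * fromℕ (count (Q ∖ v)) ⁻¹)
      ≤⟨ sum-mono-≤ term ⟩
    sum (λ v → 𝟙 (A v) * q⁻¹ + 𝟙 ((A ∩ Q) v) * (p⁻¹ * q⁻¹))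
      ≡⟨ ∑-distrib-+ (λ v → 𝟙 (A v) * q⁻¹) _ ⟩
    sum (λ v → 𝟙 (A v) * q⁻¹) + sum (λ v → 𝟙 ((A ∩ Q) v) * (p⁻¹ * q⁻¹))
      ≡⟨ cong₂ _+_ (restricted-const A q⁻¹) (restricted-const (A ∩ Q) (p⁻¹ * q⁻¹)) ⟩
    fromℕ (count A) * q⁻¹ + fromℕ (count (A ∩ Q)) * (p⁻¹ * q⁻¹)
      ≤⟨ +-monoʳ-≤ _ (*-monoʳ-≤ _ (*-nonneg _ _ (fromℕ⁻¹-nonneg p) 0≤q⁻¹)
           (fromℕ-mono-≤ (count-mono-≤ (A ∩ Q) (Q ∖ x) A∩Q⊆))) ⟩
    fromℕ (count A) * q⁻¹ + fromℕ p * (p⁻¹ * q⁻¹)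
      ≡⟨ cong (fromℕ (count A) * q⁻¹ +_) (≡.sym (*-assoc (fromℕ p) p⁻¹ q⁻¹)) ⟩
    fromℕ (count A) * q⁻¹ + fromℕ p * p⁻¹ * q⁻¹
      ≤⟨ +-monoʳ-≤ _ (*-monoʳ-≤ q⁻¹ 0≤q⁻¹ (fromℕ*⁻¹≤1 p)) ⟩
    fromℕ (count A) * q⁻¹ + 1ℝ * q⁻¹
      ≡⟨ solve 2 (λ a q → a :* q :+ con 1 :* q := (con 1 :+ a) :* q) refl (fromℕ (count A)) q⁻¹ ⟩
    fromℕ (suc (count A)) * q⁻¹ ∎
    where
    open ≤-Reasoning
    p = count (Q ∖ x)
    p⁻¹ = fromℕ p ⁻¹
    q⁻¹ = fromℕ (count Q) ⁻¹
    0≤q⁻¹ = fromℕ⁻¹-nonneg (count Q)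
    A∩Q⊆ : ∀ v → (A ∩ Q) v ≡ true → (Q ∖ x) v ≡ true
    A∩Q⊆ v h with ∧-true⁻ (A v) h
    ... | Av , Qv = ∖-intro Q Qv (∉-adjacent {A} A⊆Nx Av)
    p⁻¹≡ : 0 ℕ.< p → p⁻¹ ≡ q⁻¹ + p⁻¹ * q⁻¹
    p⁻¹≡ 0<p = subst (λ c → p⁻¹ ≡ fromℕ c ⁻¹ + p⁻¹ * fromℕ c ⁻¹) (≡.sym (count-∖ Q x Qx)) (⁻¹-split 0<p)
    term : ∀ v → 𝟙 (A v) * fromℕ (count (Q ∖ v)) ⁻¹ ≤
                 𝟙 (A v) * q⁻¹ + 𝟙 ((A ∩ Q) v) * (p⁻¹ * q⁻¹)
    term v with A v in Av | Q v in Qv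
    ... | false | _ = ≤-reflexive (solve 3 (λ a b c → con 0 :* a := con 0 :* b :+ con 0 :* c) refl _ _ _)
    ... | true | false = ≤-reflexive (trans
      (cong (λ c → 1ℝ * fromℕ c ⁻¹) (count-cong (∖-absent Q v Qv)))
      (solve 2 (λ b c → con 1 :* b := con 1 :* b :+ con 0 :* c) refl q⁻¹ (p⁻¹ * q⁻¹)))
    ... | true | true = ≤-reflexive (trans
      (cong (λ c → 1ℝ * fromℕ c ⁻¹) (ℕ.suc-injective (trans (≡.sym (count-∖ Q v Qv)) (count-∖ Q x Qx))))
      (trans (cong (1ℝ *_) (p⁻¹≡ (count-positive (Q ∖ x) v (A∩Q⊆ v (∧-true⁺ Av Qv)))))
        (solve 2 (λ b c → con 1 :* (b :+ c) := con 1 :* b :+ con 1 :* c) refl q⁻¹ (p⁻¹ * q⁻¹))))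

  -- For a fixed tuple `T` this is `U-remove₀` on `A` without `T` and on `Q ∩ N(T)`, whence the
  -- `|A| - t + 1`. The vertex `x` stays in `Q ∩ N(T)` because `T` lies in `N(x)`.
  U-remove : ∀ t A Q x → Q x ≡ true → (∀ v → A v ≡ true → E v x ≡ true) →
             sum (λ v → 𝟙 (A v) * U (A ∖ v) (Q ∖ v) t) ≤ fromℕ (suc (count A) ∸ t) * U A Q t
  U-remove zero    A Q x Qx A⊆Nx = U-remove₀ A Q x Qx A⊆Nx
  U-remove (suc t) A Q x Qx A⊆Nx = begin
    sum (λ v → 𝟙 (A v) * U (A ∖ v) (Q ∖ v) (suc t))
      ≡⟨ sum-swap A (λ v → A ∖ v) A (λ u → A ∖ u) _
           (λ u v → U (A ∖ u ∖ v) (Q ∩ E u ∖ v) t)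
           (λ v u → ∖-swap-∈ A u v)
           (λ v u → U-cong t (λ i → ∧-swapʳ (A i) _ _) (λ i → ∧-swapʳ (Q i) _ _)) ⟩
    sum (λ u → 𝟙 (A u) * sum (λ v → 𝟙 ((A ∖ u) v) * U (A ∖ u ∖ v) (Q ∩ E u ∖ v) t))
      ≤⟨ restricted-mono-≤ A (λ u Au → ≤-trans
           (U-remove t (A ∖ u) (Q ∩ E u) x (∧-true⁺ Qx (A⊆Nx u Au))
             (λ v v∈ → A⊆Nx v (proj₁ (∖-elim A u v∈))))
           (≤-reflexive (cong (λ c → fromℕ (c ∸ t) * U (A ∖ u) (Q ∩ E u) t) (≡.sym (count-∖ A u Au))))) ⟩
    sum (λ u → 𝟙 (A u) * (c * U (A ∖ u) (Q ∩ E u) t))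
      ≡⟨ sum-cong-≗ (λ u → solve 3 (λ a b c → a :* (b :* c) := b :* (a :* c)) refl (𝟙 (A u)) c _) ⟩
    sum (λ u → c * (𝟙 (A u) * U (A ∖ u) (Q ∩ E u) t))
      ≡⟨ *-distribˡ-sum c (λ u → 𝟙 (A u) * U (A ∖ u) (Q ∩ E u) t) ⟨
    c * U A Q (suc t) ∎
    where
    open ≤-Reasoning
    c = fromℕ (count A ∸ t)

  -- Double counting: a tuple `T` in `A` appears once for each `x` in `Q ∩ N(T)`, each time with the
  -- reciprocal of the size of that set, so it contributes at most 1.
  U-start : ∀ t A Q → sum (λ x → 𝟙 (Q x) * U (A ∩ E x) Q t) ≤ fromℕ (falling (count A) t)
  U-start zero A Q = begin
    sum (λ x → 𝟙 (Q x) * fromℕ (count Q) ⁻¹)  ≡⟨ restricted-const Q _ ⟩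
    fromℕ (count Q) * fromℕ (count Q) ⁻¹      ≤⟨ fromℕ*⁻¹≤1 (count Q) ⟩
    1ℝ                                        ≡⟨ +-identityʳ 1ℝ ⟨
    fromℕ 1                                   ∎
    where open ≤-Reasoning
  U-start (suc t) A Q = begin
    sum (λ x → 𝟙 (Q x) * U (A ∩ E x) Q (suc t))
      ≡⟨ sum-swap Q (λ x → A ∩ E x) A (λ v → Q ∩ E v) _
           (λ v x → U ((A ∖ v) ∩ E x) (Q ∩ E v) t)
           member
           (λ x v → U-cong t (λ i → ∧-swapʳ (A i) _ _) (λ _ → refl)) ⟩
    sum (λ v → 𝟙 (A v) * sum (λ x → 𝟙 ((Q ∩ E v) x) * U ((A ∖ v) ∩ E x) (Q ∩ E v) t))
      ≤⟨ restricted-mono-≤ A (λ v Av → ≤-trans (U-start t (A ∖ v) (Q ∩ E v))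
           (≤-reflexive (cong (λ c → fromℕ (falling (c ∸ 1) t)) (≡.sym (count-∖ A v Av))))) ⟩
    sum (λ v → 𝟙 (A v) * fromℕ (falling (count A ∸ 1) t))
      ≡⟨ restricted-const A _ ⟩
    fromℕ (count A) * fromℕ (falling (count A ∸ 1) t)
      ≡⟨ fromℕ-* (count A) _ ⟨
    fromℕ (count A ℕ.* falling (count A ∸ 1) t)
      ≡⟨ cong fromℕ (falling-∸1 (count A) t) ⟩
    fromℕ (falling (count A) (suc t)) ∎
    where
    open ≤-Reasoning
    member : ∀ x v → Q x ∧ (A ∩ E x) v ≡ A v ∧ (Q ∩ E v) x
    member x v = trans (cong (λ e → Q x ∧ (A v ∧ e)) (Graph.sym G x v))
      (trans (≡.sym (∧-assoc (Q x) (A v) (E v x)))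
        (trans (cong (_∧ E v x) (∧-comm (Q x) (A v))) (∧-assoc (A v) (Q x) (E v x))))

  -- When r vertices are free, e of which will stay unused, and t elements of a
  -- neighbourhood S are still to be placed, weight e r t * U A Q t bounds the expected
  -- reciprocal of the final number of candidates for the vertex with neighbourhood S.
  weight : ℕ → ℕ → ℕ → ℝ
  weight e r t = fromℕ (suc r ∸ t) / fromℕ (suc e ℕ.* falling r t)

  weight-denominator : ∀ e {r t} → t ℕ.≤ r → 0 ℕ.< suc e ℕ.* falling r t
  weight-denominator e {r} {t} t≤r = ℕ.*-mono-≤ (ℕ.s≤s (ℕ.z≤n {e})) (falling-positive r t t≤r)

  -- The recursion forced by placing a vertex of `S`: there are `suc r` possible images, and summing
  -- over them gives a tuple with one more entry.
  weight-hit : ∀ e r t → t ℕ.≤ r → fromℕ (suc r) * weight e (suc r) (suc t) ≡ weight e r t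
  weight-hit e r t t≤r = frac-* a _ a _ (suc r)
    (weight-denominator e (ℕ.s≤s t≤r))
    (weight-denominator e t≤r)
    (trans (ℕ-solve 4 (λ r a e f → r ⊗ a ⊗ (e ⊗ f) ⊜ a ⊗ (e ⊗ (r ⊗ f))) refl (suc r) a (suc e) (falling r t))
           (cong (λ f → a ℕ.* (suc e ℕ.* f)) (≡.sym (falling-suc r t))))
    where
    a = suc r ∸ t

  -- The recursion forced by placing a vertex outside `S`, the factor on the right being the loss in
  -- `U-remove`. With `weight-hit` and `weight e e 0 = 1` it yields the closed form of `weight`.
  weight-miss : ∀ e r t → t ℕ.≤ r →
                fromℕ (suc r) * weight e (suc r) t ≡ fromℕ (suc (suc r) ∸ t) * weight e r t
  weight-miss e r t t≤r = trans
    (frac-* b B (b ℕ.* a) C (suc r) 0<B 0<C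
      (trans (ℕ-solve 4 (λ r b e f → r ⊗ b ⊗ (e ⊗ f) ⊜ b ⊗ (e ⊗ (r ⊗ f))) refl (suc r) b (suc e) (falling r t))
        (trans (cong (λ f → b ℕ.* (suc e ℕ.* f)) (≡.sym (falling-suc r t)))
          (ℕ-solve 4 (λ a b e f → b ⊗ (e ⊗ (f ⊗ a)) ⊜ b ⊗ a ⊗ (e ⊗ f)) refl a b (suc e) (falling (suc r) t)))))
    (≡.sym (frac-* a C (b ℕ.* a) C b 0<C 0<C refl))
    where
    a = suc r ∸ t
    b = suc (suc r) ∸ t
    B = suc e ℕ.* falling (suc r) t
    C = suc e ℕ.* falling r t
    0<B : 0 ℕ.< B
    0<B = weight-denominator e (ℕ.m≤n⇒m≤1+n t≤r)
    0<C : 0 ℕ.< C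
    0<C = weight-denominator e t≤r

  weight-nonneg : ∀ e r t → 0ℝ ≤ weight e r t
  weight-nonneg e r t = *-nonneg _ _ (fromℕ-nonneg (suc r ∸ t)) (fromℕ⁻¹-nonneg (suc e ℕ.* falling r t))

  -- A hit needs no explicit deletion of `v`, since `E v` omits `v`.
  next : Bool → Pred N → Fin N → Pred N
  next true  Q v = Q ∩ E v
  next false Q v = Q ∖ v

  potential-step : ∀ e r b t A Q x → t ℕ.≤ r → count A ≡ suc r →
    Q x ≡ true → (∀ v → A v ≡ true → E v x ≡ true) →
    let t′ = (if b then 1 else 0) ℕ.+ t in
    sum (λ v → 𝟙 (A v) * (weight e r t * U (A ∖ v) (next b Q v) t)) ≤
    fromℕ (suc r) * (weight e (suc r) t′ * U A Q t′)
  potential-step e r b t A Q x t≤r |A| Qx A⊆Nx = begin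
    sum (λ v → 𝟙 (A v) * (w * U (A ∖ v) (next b Q v) t))
      ≡⟨ sum-cong-≗ (λ v → solve 3 (λ a b c → a :* (b :* c) := b :* (a :* c)) refl (𝟙 (A v)) w _) ⟩
    sum (λ v → w * (𝟙 (A v) * U (A ∖ v) (next b Q v) t))
      ≡⟨ *-distribˡ-sum w (λ v → 𝟙 (A v) * U (A ∖ v) (next b Q v) t) ⟨
    w * sum (λ v → 𝟙 (A v) * U (A ∖ v) (next b Q v) t)
      ≤⟨ bound b ⟩
    fromℕ (suc r) * weight e (suc r) t′ * U A Q t′
      ≡⟨ *-assoc _ _ _ ⟩
    fromℕ (suc r) * (weight e (suc r) t′ * U A Q t′) ∎
    where
    open ≤-Reasoning
    w = weight e r t
    t′ = (if b then 1 else 0) ℕ.+ t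
    bound : ∀ b → let t′ = (if b then 1 else 0) ℕ.+ t in
            w * sum (λ v → 𝟙 (A v) * U (A ∖ v) (next b Q v) t) ≤
            fromℕ (suc r) * weight e (suc r) t′ * U A Q t′
    -- `U A Q (suc t)` unfolds to this very sum, so a hit loses nothing.
    bound true  = ≤-reflexive (cong (_* U A Q (suc t)) (≡.sym (weight-hit e r t t≤r)))
    bound false = begin
      w * sum (λ v → 𝟙 (A v) * U (A ∖ v) (Q ∖ v) t)
        ≤⟨ *-monoˡ-≤ w (weight-nonneg e r t) (U-remove t A Q x Qx A⊆Nx) ⟩
      w * (fromℕ (suc (count A) ∸ t) * U A Q t)
        ≡⟨ cong (λ c → w * (fromℕ (suc c ∸ t) * U A Q t)) |A| ⟩
      w * (fromℕ (suc (suc r) ∸ t) * U A Q t)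
        ≡⟨ solve 3 (λ a b c → a :* (b :* c) := b :* a :* c) refl w (fromℕ (suc (suc r) ∸ t)) (U A Q t) ⟩
      fromℕ (suc (suc r) ∸ t) * w * U A Q t
        ≡⟨ cong (_* U A Q t) (≡.sym (weight-miss e r t t≤r)) ⟩
      fromℕ (suc r) * weight e (suc r) t * U A Q t ∎

  -- Q′ w are the candidates left for w ∈ W₁, where S w ⊆ W₂ contains its neighbours.
  record Placement {k m} (S : Fin k → Pred m) (A : Pred N) (Q : Fin k → Pred N) (x : Fin N) : Set where
    field
      φ           : Fin m → Fin N
      φ-injective : Injective _≡_ _≡_ φ
      φ-in        : ∀ i → A (φ i) ≡ true
      Q′          : Fin k → Pred N
      Q′-sum      : sum (λ w → fromℕ (count (Q′ w)) ⁻¹) ≤ 1ℝ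
      Q′-x        : ∀ w → Q′ w x ≡ true
      Q′⊆Q        : ∀ w y → Q′ w y ≡ true → Q w y ≡ true
      Q′-avoids   : ∀ w y i → Q′ w y ≡ true → φ i ≢ y
      Q′-adjacent : ∀ w y i → S w i ≡ true → Q′ w y ≡ true → E (φ i) y ≡ true

  cons-injective : ∀ {m} (v : Fin N) (φ : Fin m → Fin N) → (∀ i → φ i ≢ v) →
                   Injective _≡_ _≡_ φ → Injective _≡_ _≡_ (cons v φ)
  cons-injective v φ φ≢v inj {zero}  {zero}  eq = refl
  cons-injective v φ φ≢v inj {zero}  {suc j} eq = ⊥-elim (φ≢v j (≡.sym eq))
  cons-injective v φ φ≢v inj {suc i} {zero}  eq = ⊥-elim (φ≢v i eq)
  cons-injective v φ φ≢v inj {suc i} {suc j} eq = cong suc (inj eq)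

  -- The method of conditional expectations: some image of the first vertex
  -- does not increase the weighted potential.
  place : ∀ {k} m e (S : Fin k → Pred m) A Q x → count A ≡ m ℕ.+ e →
          (∀ w → Q w x ≡ true) → (∀ v → A v ≡ true → E v x ≡ true) →
          sum (λ w → weight e (m ℕ.+ e) (count (S w)) * U A (Q w) (count (S w))) ≤ 1ℝ →
          Placement S A Q x
  place zero e S A Q x |A| Qx A⊆Nx Σ≤1 = record
    { φ = λ () ; φ-injective = λ { {()} } ; φ-in = λ ()
    ; Q′ = Q
    -- With nothing left to place, every `S w` is empty and every weight is 1: the potential has
    -- become the sum of reciprocals.
    ; Q′-sum = subst (_≤ 1ℝ) (sum-cong-≗ λ w → trans (cong (_* fromℕ (count (Q w)) ⁻¹) weight≡1) (*-identityˡ _)) Σ≤1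
    ; Q′-x = Qx ; Q′⊆Q = λ w y h → h ; Q′-avoids = λ w y () ; Q′-adjacent = λ w y () }
    where
    weight≡1 : weight e e 0 ≡ 1ℝ
    weight≡1 = trans (cong (λ c → fromℕ (suc e) / fromℕ c) (ℕ.*-identityʳ (suc e)))
                     (*-inverseʳ (fromℕ-positive {suc e} (ℕ.s≤s ℕ.z≤n)))
  place {k} (suc m) e S A Q x |A| Qx A⊆Nx Σ≤1
    with pick A (λ v → 𝟙 (A v) * pot v) (𝟙 ∘ A) total≤
           (λ v v∉A → ≤-reflexive (trans (cong 𝟙 v∉A) (≡.sym (trans (cong (λ b → 𝟙 b * pot v) v∉A) (zeroˡ _)))))
    where
    S′ : Fin k → Pred m
    S′ w = S w ∘ suc
    Q⁺ : Fin N → Fin k → Pred N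
    Q⁺ v w = next (S w zero) (Q w) v
    pot : Fin N → ℝ
    pot v = sum (λ w → weight e (m ℕ.+ e) (count (S′ w)) * U (A ∖ v) (Q⁺ v w) (count (S′ w)))
    total≤ : sum (λ v → 𝟙 (A v) * pot v) ≤ sum (𝟙 ∘ A)
    total≤ = begin
      sum (λ v → 𝟙 (A v) * pot v)
        ≡⟨ sum-cong-≗ (λ v → *-distribˡ-sum (𝟙 (A v))
             (λ w → weight e (m ℕ.+ e) (count (S′ w)) * U (A ∖ v) (Q⁺ v w) (count (S′ w)))) ⟩
      sum (λ v → sum (λ w → 𝟙 (A v) * (weight e (m ℕ.+ e) (count (S′ w)) * U (A ∖ v) (Q⁺ v w) (count (S′ w)))))
        ≡⟨ ∑-comm (λ v w → 𝟙 (A v) * (weight e (m ℕ.+ e) (count (S′ w)) * U (A ∖ v) (Q⁺ v w) (count (S′ w)))) ⟩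
      sum (λ w → sum (λ v → 𝟙 (A v) * (weight e (m ℕ.+ e) (count (S′ w)) * U (A ∖ v) (Q⁺ v w) (count (S′ w)))))
        ≤⟨ sum-mono-≤ (λ w → potential-step e (m ℕ.+ e) (S w zero) (count (S′ w)) A (Q w) x
             (ℕ.≤-trans (count≤n (S′ w)) (ℕ.m≤m+n m e)) |A| (Qx w) A⊆Nx) ⟩
      sum (λ w → fromℕ (suc (m ℕ.+ e)) * (weight e (suc (m ℕ.+ e)) (count (S w)) * U A (Q w) (count (S w))))
        ≡⟨ *-distribˡ-sum _ (λ w → weight e (suc (m ℕ.+ e)) (count (S w)) * U A (Q w) (count (S w))) ⟨
      fromℕ (suc (m ℕ.+ e)) * sum (λ w → weight e (suc (m ℕ.+ e)) (count (S w)) * U A (Q w) (count (S w)))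
        ≤⟨ *-monoˡ-≤ _ (fromℕ-nonneg (suc (m ℕ.+ e))) Σ≤1 ⟩
      fromℕ (suc (m ℕ.+ e)) * 1ℝ
        ≡⟨ *-identityʳ _ ⟩
      fromℕ (suc (m ℕ.+ e))
        ≡⟨ cong fromℕ |A| ⟨
      fromℕ (count A)
        ≡⟨ fromℕ-count A ⟩
      sum (𝟙 ∘ A) ∎
      where open ≤-Reasoning
  ... | inj₂ (_ , none) = ⊥-elim (0≢suc (trans (≡.sym (count-none A none)) |A|))
    where
    0≢suc : ∀ {n} → 0 ≢ suc n
    0≢suc ()
  ... | inj₁ (v , Av , pot≤1) = record
    { φ = cons v φ
    ; φ-injective = cons-injective v φ (λ i → proj₂ (∖-elim A v (φ-in i))) φ-injective
    ; φ-in = λ { zero → Av ; (suc i) → proj₁ (∖-elim A v (φ-in i)) }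
    ; Q′ = Q′ ; Q′-sum = Q′-sum ; Q′-x = Q′-x
    ; Q′⊆Q = λ w y h → proj₁ (next-elim (S w zero) (Q w) (Q′⊆Q w y h))
    ; Q′-avoids = λ { w y zero h refl → proj₁ (proj₂ (next-elim (S w zero) (Q w) (Q′⊆Q w y h))) refl
                    ; w y (suc i) h → Q′-avoids w y i h }
    ; Q′-adjacent = λ { w y zero Sw h → proj₂ (proj₂ (next-elim (S w zero) (Q w) (Q′⊆Q w y h))) Sw
                      ; w y (suc i) Sw h → Q′-adjacent w y i Sw h }
    }
    where
    𝟙-cancel : ∀ {b a} → b ≡ true → 𝟙 b * a ≤ 𝟙 b → a ≤ 1ℝ
    𝟙-cancel refl = subst (_≤ 1ℝ) (*-identityˡ _)
    next-elim : ∀ b P {y} → next b P v y ≡ true → P y ≡ true × y ≢ v × (b ≡ true → E v y ≡ true)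
    next-elim true P {y} h with ∧-true⁻ (P y) h
    ... | Py , vy = Py , (λ { refl → true≢false vy (irrefl G y) }) , λ _ → vy
    next-elim false P h with ∖-elim P v h
    ... | Py , y≢v = Py , y≢v , λ ()
    next-intro : ∀ b {P} → P x ≡ true → next b P v x ≡ true
    next-intro true  Px = ∧-true⁺ Px (A⊆Nx v Av)
    next-intro false {P} Px = ∖-intro P Px (∉-adjacent {A} A⊆Nx Av ∘ ≡.sym)
    open Placement (place m e (λ w → S w ∘ suc) (A ∖ v) (λ w → next (S w zero) (Q w) v) x
      (ℕ.suc-injective (trans (≡.sym (count-∖ A v Av)) |A|))
      (λ w → next-intro (S w zero) (Qx w))
      (λ u u∈ → A⊆Nx u (proj₁ (∖-elim A v u∈)))
      (𝟙-cancel Av pot≤1))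

  -- Some Q w has at least k elements, since the reciprocals sum to at most 1;
  -- it is served last.
  distinct-representatives : ∀ k (Q : Fin k → Pred N) → (∀ w → 0 ℕ.< count (Q w)) →
    sum (λ w → fromℕ (count (Q w)) ⁻¹) ≤ 1ℝ →
    ∃ λ (ψ : Fin k → Fin N) → Injective _≡_ _≡_ ψ × (∀ w → Q w (ψ w) ≡ true)
  distinct-representatives zero Q 0<Q Σ≤1 = (λ ()) , (λ { {()} }) , λ ()
  distinct-representatives (suc k) Q 0<Q Σ≤1
    with pick (λ _ → true) (λ w → fromℕ (count (Q w)) ⁻¹) (λ _ → fromℕ (suc k) ⁻¹)
           (subst (sum (λ w → fromℕ (count (Q w)) ⁻¹) ≤_) (≡.sym (trans (sum-const (suc k) (fromℕ (suc k) ⁻¹)) (*-inverseʳ (fromℕ-positive {suc k} (ℕ.s≤s ℕ.z≤n))))) Σ≤1)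
           (λ _ ())
  ... | inj₂ (_ , none) = ⊥-elim (true≢false refl (none zero))
  ... | inj₁ (w , _ , Qw⁻¹≤)
    with distinct-representatives k (Q ∘ punchIn w) (0<Q ∘ punchIn w)
           (≤-trans (subst₂ _≤_ (+-identityˡ _) (≡.sym (sum-remove {i = w} (λ w → fromℕ (count (Q w)) ⁻¹)))
             (+-monoˡ-≤ _ (fromℕ⁻¹-nonneg (count (Q w))))) Σ≤1)
  ...   | ψ , ψ-inj , Qψ
    -- Nonemptiness matters here: an empty `Q w` would have reciprocal 0 and satisfy `Qw⁻¹≤` as
    -- well.
    with fresh k ψ (Q w) (fromℕ-cancel-≤ (⁻¹-antitone (fromℕ-positive (0<Q w)) (fromℕ-positive {suc k} (ℕ.s≤s ℕ.z≤n)) Qw⁻¹≤))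
  ...     | y , Qy , ψ≢y = ψ′ , ψ′-inj , Qψ′
    where
    ψ′ : Fin (suc k) → Fin N
    ψ′ = insertAt ψ w y
    ψ′-w : ψ′ w ≡ y
    ψ′-w = insertAt-lookup ψ w y
    ψ′-other : ∀ {i} (w≢i : w ≢ i) → ψ′ i ≡ ψ (punchOut w≢i)
    ψ′-other w≢i = trans (cong ψ′ (≡.sym (punchIn-punchOut w≢i))) (insertAt-punchIn ψ w y (punchOut w≢i))
    Qψ′ : ∀ i → Q i (ψ′ i) ≡ true
    Qψ′ i with w ≟ i
    ... | yes refl = trans (cong (Q w) ψ′-w) Qy
    ... | no w≢i = trans (cong (Q i) (ψ′-other w≢i))
                     (subst (λ j → Q j (ψ (punchOut w≢i)) ≡ true) (punchIn-punchOut w≢i) (Qψ (punchOut w≢i)))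
    ψ′-inj : Injective _≡_ _≡_ ψ′
    ψ′-inj {i} {j} eq with w ≟ i | w ≟ j
    ... | yes refl | yes refl = refl
    ... | yes refl | no w≢j = ⊥-elim (ψ≢y _ (trans (≡.sym (ψ′-other w≢j)) (trans (≡.sym eq) ψ′-w)))
    ... | no w≢i | yes refl = ⊥-elim (ψ≢y _ (trans (≡.sym (ψ′-other w≢i)) (trans eq ψ′-w)))
    ... | no w≢i | no w≢j = trans (≡.sym (punchIn-punchOut w≢i)) (trans (cong (punchIn w)
            (ψ-inj (trans (≡.sym (ψ′-other w≢i)) (trans eq (ψ′-other w≢j))))) (punchIn-punchOut w≢j))

does-true⁻ : ∀ {P : Set} (P? : Dec P) → does P? ≡ true → P
does-true⁻ (yes p) _ = p

does-false⁻ : ∀ {P : Set} (P? : Dec P) → does P? ≡ false → ¬ P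
does-false⁻ (no ¬p) _ = ¬p

-- Lower bounds for power sums by Chebyshev's inequality.

module PowerSums (R : RealField) where
  open OrderedField R

  -- Replaces differences by summands, so that the semiring solver can be used.
  ≤⇒+ : ∀ {a b} → a ≤ b → ∃ λ c → 0ℝ ≤ c × b ≡ a + c
  ≤⇒+ {a} {b} a≤b = b + - a , subst (_≤ b + - a) (-‿inverseʳ a) (+-monoˡ-≤ (- a) a≤b) ,
    ≡.sym (trans (+-comm a _) (trans (+-assoc b (- a) a) (trans (cong (b +_) (-‿inverseˡ a)) (+-identityʳ b))))

  rearrange : ∀ {x y u v} → x ≤ y → u ≤ v → x * v + y * u ≤ x * u + y * v
  rearrange {x} {y} {u} {v} x≤y u≤v with ≤⇒+ x≤y | ≤⇒+ u≤v
  ... | c , 0≤c , refl | c′ , 0≤c′ , refl = subst₂ _≤_ (+-identityʳ _)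
    (solve 4 (λ x c u c′ → x :* (u :+ c′) :+ (x :+ c) :* u :+ c :* c′ := x :* u :+ (x :+ c) :* (u :+ c′)) refl x c u c′)
    (+-monoʳ-≤ _ (*-nonneg c c′ 0≤c 0≤c′))

  power-rearrange : ∀ e {x b} → 0ℝ ≤ x → 0ℝ ≤ b → x ^ⁿ e * b + b ^ⁿ e * x ≤ x ^ⁿ e * x + b ^ⁿ e * b
  power-rearrange e {x} {b} 0≤x 0≤b with ≤-total x b
  ... | inj₁ x≤b = rearrange (^-monoˡ-≤ e 0≤x x≤b) x≤b
  ... | inj₂ b≤x = subst₂ _≤_ (+-comm _ _) (+-comm _ _) (rearrange (^-monoˡ-≤ e 0≤b b≤x) b≤x)

  module _ {n} (D : Fin n → ℝ) (0≤D : ∀ x → 0ℝ ≤ D x)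
           (b : ℝ) (0≤b : 0ℝ ≤ b) (nb≤ΣD : fromℕ n * b ≤ sum D) where

    -- Sum `(D^e - b^e)(D - b) ≥ 0` over all vertices; the terms with factor `b^e` add up to
    -- `b^e (ΣD - nb)`, which is nonnegative. Both sides are kept free of subtraction.
    power-sum-step : ∀ e → b * sum (λ x → D x ^ⁿ e) ≤ sum (λ x → D x ^ⁿ suc e)
    power-sum-step e = +-cancelʳ-≤ (b ^ⁿ e * sum D) (begin
      b * sum (λ x → D x ^ⁿ e) + b ^ⁿ e * sum D
        ≡⟨ cong₂ _+_ (trans (*-comm b _) (*-distribʳ-sum b (λ x → D x ^ⁿ e))) (*-distribˡ-sum (b ^ⁿ e) D) ⟩
      sum (λ x → D x ^ⁿ e * b) + sum (λ x → b ^ⁿ e * D x)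
        ≡⟨ ∑-distrib-+ (λ x → D x ^ⁿ e * b) (λ x → b ^ⁿ e * D x) ⟨
      sum (λ x → D x ^ⁿ e * b + b ^ⁿ e * D x)
        ≤⟨ sum-mono-≤ (λ x → power-rearrange e (0≤D x) 0≤b) ⟩
      sum (λ x → D x ^ⁿ e * D x + b ^ⁿ e * b)
        ≡⟨ ∑-distrib-+ (λ x → D x ^ⁿ e * D x) (λ _ → b ^ⁿ e * b) ⟩
      sum (λ x → D x ^ⁿ e * D x) + sum {n} (λ _ → b ^ⁿ e * b)
        ≡⟨ cong₂ _+_ (sum-cong-≗ (λ x → *-comm (D x ^ⁿ e) (D x))) (trans (sum-const n (b ^ⁿ e * b))
             (solve 3 (λ n p b → n :* (p :* b) := p :* (n :* b)) refl (fromℕ n) (b ^ⁿ e) b)) ⟩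
      sum (λ x → D x ^ⁿ suc e) + b ^ⁿ e * (fromℕ n * b)
        ≤⟨ +-monoʳ-≤ _ (*-monoˡ-≤ (b ^ⁿ e) (^-nonneg e 0≤b) nb≤ΣD) ⟩
      sum (λ x → D x ^ⁿ suc e) + b ^ⁿ e * sum D ∎)
      where open ≤-Reasoning

    power-sum : ∀ e → fromℕ n * b ^ⁿ e ≤ sum (λ x → D x ^ⁿ e)
    power-sum zero    = ≤-reflexive (≡.sym (sum-const n 1ℝ))
    power-sum (suc e) = begin
      fromℕ n * (b * b ^ⁿ e)    ≡⟨ solve 3 (λ n b p → n :* (b :* p) := b :* (n :* p)) refl (fromℕ n) b (b ^ⁿ e) ⟩
      b * (fromℕ n * b ^ⁿ e)    ≤⟨ *-monoˡ-≤ b 0≤b (power-sum e) ⟩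
      b * sum (λ x → D x ^ⁿ e)  ≤⟨ power-sum-step e ⟩
      sum (λ x → D x ^ⁿ suc e)  ∎
      where open ≤-Reasoning

-- Consequences of the density for the degrees.

module DensityBounds (R : RealField) {N : ℕ} (G : Graph N) where
  open OrderedField R

  module _ (α : ℝ) (0<α : 0ℝ < α) (α≤density : α ≤ density R G) where

    pairs-positive : 0 ℕ.< pairs N
    pairs-positive = nonzero (pairs N) refl
      where
      nonzero : ∀ c → pairs N ≡ c → 0 ℕ.< c
      nonzero (suc c) _ = ℕ.s≤s ℕ.z≤n
      -- Division by 0 returns 0, so without pairs the density would be 0, below `α`.
      nonzero zero eq = ⊥-elim (<⇒≱ 0<α (subst (α ≤_)
        (trans (cong (λ c → fromℕ (edges G) / fromℕ c) eq)
          (trans (cong (fromℕ (edges G) *_) inv-zero) (zeroʳ _))) α≤density))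

    α*pairs≤edges : α * fromℕ (pairs N) ≤ fromℕ (edges G)
    α*pairs≤edges = ≤-/⁻ (fromℕ-positive pairs-positive) α≤density

    α≤1 : α ≤ 1ℝ
    α≤1 = *-cancelʳ-≤ (fromℕ (pairs N)) (fromℕ-positive pairs-positive) (begin
      α * fromℕ (pairs N)   ≤⟨ α*pairs≤edges ⟩
      fromℕ (edges G)       ≤⟨ fromℕ-mono-≤ (halve (edges G) (pairs N) (ℕ.≤-trans (edges-upper G) (ℕ.≤-reflexive (≡.sym (pairs+pairs N))))) ⟩
      fromℕ (pairs N)       ≡⟨ *-identityˡ _ ⟨
      1ℝ * fromℕ (pairs N)  ∎)
      where
      open ≤-Reasoning
      halve : ∀ a b → a ℕ.+ a ℕ.≤ b ℕ.+ b → a ℕ.≤ b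
      halve a b h = ℕ.≮⇒≥ (λ b<a → ℕ.<⇒≱ (ℕ.+-mono-< b<a b<a) h)

    degree-sum : fromℕ N * (α * fromℕ (N ∸ 1)) ≤ sum (λ x → fromℕ (deg G x))
    degree-sum = begin
      fromℕ N * (α * fromℕ (N ∸ 1))            ≡⟨ solve 3 (λ n a m → n :* (a :* m) := a :* (n :* m)) refl (fromℕ N) α (fromℕ (N ∸ 1)) ⟩
      α * (fromℕ N * fromℕ (N ∸ 1))            ≡⟨ cong (α *_) (fromℕ-* N (N ∸ 1)) ⟨
      α * fromℕ (N ℕ.* (N ∸ 1))                ≡⟨ cong (λ c → α * fromℕ c) (pairs+pairs N) ⟨
      α * fromℕ (pairs N ℕ.+ pairs N)          ≡⟨ cong (α *_) (fromℕ-+ (pairs N) (pairs N)) ⟩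
      α * (fromℕ (pairs N) + fromℕ (pairs N))  ≡⟨ distribˡ α _ _ ⟩
      α * fromℕ (pairs N) + α * fromℕ (pairs N) ≤⟨ +-mono-≤ α*pairs≤edges α*pairs≤edges ⟩
      fromℕ (edges G) + fromℕ (edges G)        ≡⟨ fromℕ-+ (edges G) (edges G) ⟨
      fromℕ (edges G ℕ.+ edges G)              ≡⟨ cong fromℕ (handshake G) ⟨
      fromℕ (ℕΣ.sum (deg G))                   ≡⟨ fromℕ-sum (deg G) ⟩
      sum (λ x → fromℕ (deg G x))              ∎
      where
      open ≤-Reasoning
      import Algebra.Properties.Semiring.Sum ℕ.+-*-semiring as ℕΣ
      fromℕ-sum : ∀ {n} (f : Fin n → ℕ) → fromℕ (ℕΣ.sum f) ≡ sum (fromℕ ∘ f)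
      fromℕ-sum {zero}  f = refl
      fromℕ-sum {suc n} f = trans (fromℕ-+ (f zero) _) (cong (fromℕ (f zero) +_) (fromℕ-sum (f ∘ suc)))

-- Choice of the centre `x` and bound on its initial potential.

-- Here k = |W₁|, m = |W₂|, d = e + 1, and b is the lower bound on the average degree.
-- Everything rests on Σ D^e (D - m) ≥ (K + 1) b^e (b - m) and on n < b.
module _ (R : RealField) where
  open OrderedField R

  module Centre {K : ℕ} (G : Graph (suc K)) (α ε : ℝ) (0<α : 0ℝ < α) (0<ε : 0ℝ < ε)
    (α≤density : α ≤ density R G)
    (e k m : ℕ) (2≤e : 2 ℕ.≤ e) (d≤m : suc e ℕ.≤ m)
    (large : (1ℝ + ε) * fromℕ (k ℕ.+ m) ≤ fromℕ (suc K) * α ^ⁿ suc e)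
    (ratio : fromℕ (m ℕ.^ suc e) / fromℕ (falling m (suc e)) ≤ 1ℝ + ε)
    where
    open PowerSums R
    open DensityBounds R G
    open Potential R G
    open ≤-Reasoning

    d : ℕ
    d = suc e

    0<1+ε : 0ℝ < 1ℝ + ε
    0<1+ε = <-≤-trans 0<1 (subst (_≤ 1ℝ + ε) (+-identityʳ 1ℝ) (+-monoʳ-≤ 1ℝ (proj₁ 0<ε)))

    0<m : 0 ℕ.< m
    0<m = ℕ.≤-trans (ℕ.s≤s ℕ.z≤n) d≤m

    0<fm : 0ℝ < fromℕ m
    0<fm = fromℕ-positive 0<m

    m^≤ : fromℕ (m ℕ.^ d) ≤ (1ℝ + ε) * fromℕ (falling m d)
    m^≤ = /-≤⁻ (fromℕ-positive (falling-positive m d d≤m)) ratio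

    -- Cancelling `m^e` in the ratio condition leaves `m ≤ (1+ε)(m-1)`.
    1≤ε[m-1] : 1ℝ ≤ ε * fromℕ (m ∸ 1)
    1≤ε[m-1] = +-cancelʳ-≤ (fromℕ (m ∸ 1)) (begin
      1ℝ + fromℕ (m ∸ 1)                      ≡⟨ cong fromℕ (ℕ.m+[n∸m]≡n 0<m) ⟩
      fromℕ m                                 ≤⟨ *-cancelˡ-≤ (fromℕ (m ℕ.^ e)) 0<m^e cancelled ⟩
      (1ℝ + ε) * fromℕ (m ∸ 1)                ≡⟨ solve 2 (λ ε p → (con 1 :+ ε) :* p := ε :* p :+ p) refl ε (fromℕ (m ∸ 1)) ⟩
      ε * fromℕ (m ∸ 1) + fromℕ (m ∸ 1)       ∎)
      where
      0<m^e : 0ℝ < fromℕ (m ℕ.^ e)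
      0<m^e = subst (0ℝ <_) (≡.sym (fromℕ-^ m e)) (^-positive e 0<fm)
      cancelled : fromℕ (m ℕ.^ e) * fromℕ m ≤ fromℕ (m ℕ.^ e) * ((1ℝ + ε) * fromℕ (m ∸ 1))
      cancelled = begin
        fromℕ (m ℕ.^ e) * fromℕ m                      ≡⟨ trans (*-comm _ _) (≡.sym (fromℕ-* m (m ℕ.^ e))) ⟩
        fromℕ (m ℕ.^ d)                                ≤⟨ m^≤ ⟩
        (1ℝ + ε) * fromℕ (falling m d)                 ≤⟨ *-monoˡ-≤ _ (proj₁ 0<1+ε) (fromℕ-mono-≤ (falling≤^*pred m (ℕ.<⇒≤ 2≤e))) ⟩
        (1ℝ + ε) * fromℕ (m ℕ.^ e ℕ.* (m ∸ 1))         ≡⟨ cong ((1ℝ + ε) *_) (fromℕ-* (m ℕ.^ e) (m ∸ 1)) ⟩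
        (1ℝ + ε) * (fromℕ (m ℕ.^ e) * fromℕ (m ∸ 1))   ≡⟨ solve 3 (λ a b c → a :* (b :* c) := b :* (a :* c)) refl (1ℝ + ε) (fromℕ (m ℕ.^ e)) (fromℕ (m ∸ 1)) ⟩
        fromℕ (m ℕ.^ e) * ((1ℝ + ε) * fromℕ (m ∸ 1))   ∎

    n : ℝ
    n = fromℕ (k ℕ.+ m)

    b : ℝ
    b = α * fromℕ K

    0≤b : 0ℝ ≤ b
    0≤b = *-nonneg α _ (proj₁ 0<α) (fromℕ-nonneg K)

    α<εn : α < ε * n
    α<εn = begin-strict
      α                  ≤⟨ α≤1 α 0<α α≤density ⟩
      1ℝ                 ≤⟨ 1≤ε[m-1] ⟩
      ε * fromℕ (m ∸ 1)  <⟨ *-monoˡ-< ε 0<ε (fromℕ-mono-< (ℕ.≤-reflexive (ℕ.m+[n∸m]≡n 0<m))) ⟩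
      ε * fromℕ m        ≤⟨ *-monoˡ-≤ ε (proj₁ 0<ε) (fromℕ-mono-≤ (ℕ.m≤n+m m k)) ⟩
      ε * n              ∎

    -- The size hypothesis gives `(1+ε) n ≤ (K+1) α = b + α`; the excess `α` is smaller than `ε n`.
    n<b : n < b
    n<b = +-cancelʳ-< (ε * n) (begin-strict
      n + ε * n                             ≡⟨ solve 2 (λ n ε → n :+ ε :* n := (con 1 :+ ε) :* n) refl n ε ⟩
      (1ℝ + ε) * n                          ≤⟨ large ⟩
      fromℕ (suc K) * (α * α ^ⁿ e)          ≤⟨ *-monoˡ-≤ _ (fromℕ-nonneg (suc K))
                                                 (*-monoˡ-≤ α (proj₁ 0<α) (^≤1 e (proj₁ 0<α) (α≤1 α 0<α α≤density))) ⟩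
      fromℕ (suc K) * (α * 1ℝ)              ≡⟨ solve 2 (λ K α → (con 1 :+ K) :* (α :* con 1) := α :* K :+ α) refl (fromℕ K) α ⟩
      b + α                                 <⟨ +-monoʳ-< b α<εn ⟩
      b + ε * n                             ∎)

    D : Fin (suc K) → ℝ
    D x = fromℕ (deg G x)

    U₀ : Fin (suc K) → ℝ
    U₀ x = U (E x) (λ _ → true) d

    ΣU₀≤ : sum U₀ ≤ fromℕ K ^ⁿ d
    ΣU₀≤ = begin
      sum U₀                                                        ≡⟨ sum-cong-≗ (λ x → *-identityˡ (U₀ x)) ⟨
      sum (λ x → 1ℝ * U₀ x)                                         ≤⟨ U-start d (λ _ → true) (λ _ → true) ⟩
      fromℕ (falling (count {suc K} (λ _ → true)) d)                ≡⟨ cong (λ c → fromℕ (falling c d)) (count-all (suc K)) ⟩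
      fromℕ (falling (suc K) d)                                     ≤⟨ fromℕ-mono-≤ (falling≤pred^ K (ℕ.s≤s 2≤e)) ⟩
      fromℕ (K ℕ.^ d)                                               ≡⟨ fromℕ-^ K d ⟩
      fromℕ K ^ⁿ d                                                  ∎

    m≤b : fromℕ m ≤ b
    m≤b = ≤-trans (fromℕ-mono-≤ (ℕ.m≤n+m m k)) (proj₁ n<b)

    -- `cost x ≤ gain x` is `(1+ε) k U₀ ≤ D^e (D - m)` with the subtraction cleared.
    cost gain : Fin (suc K) → ℝ
    cost x = (1ℝ + ε) * (fromℕ k * U₀ x) + fromℕ m * D x ^ⁿ e
    gain x = D x ^ⁿ d

    -- Here `c` stands for `b - m`. The two power-sum bounds give `Σ D^e (D - m) ≥ c (K+1) b^e`, and
    -- `bulk` compares this with the bound on `ΣU₀`.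
    cost-gap : ∀ c → 0ℝ ≤ c → b ≡ fromℕ m + c → sum cost < sum gain
    cost-gap c 0≤c b≡m+c = begin-strict
      sum cost
        ≡⟨ ∑-distrib-+ (λ x → (1ℝ + ε) * (fromℕ k * U₀ x)) (λ x → fromℕ m * D x ^ⁿ e) ⟩
      sum (λ x → (1ℝ + ε) * (fromℕ k * U₀ x)) + sum (λ x → fromℕ m * D x ^ⁿ e)
        ≡⟨ cong₂ _+_ (trans (cong ((1ℝ + ε) *_) (*-distribˡ-sum (fromℕ k) U₀)) (*-distribˡ-sum (1ℝ + ε) (λ x → fromℕ k * U₀ x)))
                     (*-distribˡ-sum (fromℕ m) (λ x → D x ^ⁿ e)) ⟨
      (1ℝ + ε) * (fromℕ k * sum U₀) + fromℕ m * P
        ≤⟨ +-monoˡ-≤ _ (*-monoˡ-≤ _ (proj₁ 0<1+ε) (*-monoˡ-≤ _ (fromℕ-nonneg k) ΣU₀≤)) ⟩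
      (1ℝ + ε) * (fromℕ k * fromℕ K ^ⁿ d) + fromℕ m * P
        ≡⟨ +-comm _ _ ⟩
      fromℕ m * P + (1ℝ + ε) * (fromℕ k * fromℕ K ^ⁿ d)
        <⟨ +-monoʳ-< (fromℕ m * P) bulk ⟩
      fromℕ m * P + c * (fromℕ (suc K) * b ^ⁿ e)
        ≤⟨ +-monoʳ-≤ _ (*-monoˡ-≤ c 0≤c (power-sum D (λ x → fromℕ-nonneg (deg G x)) b 0≤b (degree-sum α 0<α α≤density) e)) ⟩
      fromℕ m * P + c * P
        ≡⟨ distribʳ P (fromℕ m) c ⟨
      (fromℕ m + c) * P
        ≡⟨ cong (_* P) b≡m+c ⟨
      b * P
        ≤⟨ power-sum-step D (λ x → fromℕ-nonneg (deg G x)) b 0≤b (degree-sum α 0<α α≤density) e ⟩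
      sum gain ∎
      where
      P = sum (λ x → D x ^ⁿ e)
      0<b : 0ℝ < b
      0<b = <-≤-trans 0<fm m≤b
      0<K : 0ℝ < fromℕ K
      0<K = fromℕ-nonneg K , λ 0≡K → proj₂ 0<b (≡.sym (trans (cong (α *_) (≡.sym 0≡K)) (zeroʳ α)))
      k<c : fromℕ k < c
      k<c = +-cancelʳ-< (fromℕ m) (subst₂ _<_ (fromℕ-+ k m) (trans b≡m+c (+-comm (fromℕ m) c)) n<b)
      -- This says `k/n < 1 - m/b`; the left side is `1 - m/n`, and `n < b`.
      kb<cn : fromℕ k * b < c * n
      kb<cn = begin-strict
        fromℕ k * b                            ≡⟨ cong (fromℕ k *_) b≡m+c ⟩
        fromℕ k * (fromℕ m + c)                ≡⟨ solve 3 (λ k m c → k :* (m :+ c) := c :* k :+ m :* k) refl (fromℕ k) (fromℕ m) c ⟩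
        c * fromℕ k + fromℕ m * fromℕ k        <⟨ +-monoʳ-< (c * fromℕ k) (*-monoˡ-< (fromℕ m) 0<fm k<c) ⟩
        c * fromℕ k + fromℕ m * c              ≡⟨ solve 3 (λ k m c → c :* k :+ m :* c := c :* (k :+ m)) refl (fromℕ k) (fromℕ m) c ⟩
        c * (fromℕ k + fromℕ m)                ≡⟨ cong (c *_) (fromℕ-+ k m) ⟨
        c * n                                  ∎
      -- After multiplication by `b`, the size hypothesis and `α^d K^d = b^d` reduce the claim to
      -- `kb<cn`.
      bulk : (1ℝ + ε) * (fromℕ k * fromℕ K ^ⁿ d) < c * (fromℕ (suc K) * b ^ⁿ e)
      bulk = *-cancelˡ-< b 0<b (begin-strict
        b * ((1ℝ + ε) * (fromℕ k * fromℕ K ^ⁿ d))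
          ≡⟨ solve 4 (λ b s k p → b :* (s :* (k :* p)) := s :* p :* (k :* b)) refl b (1ℝ + ε) (fromℕ k) (fromℕ K ^ⁿ d) ⟩
        (1ℝ + ε) * fromℕ K ^ⁿ d * (fromℕ k * b)
          <⟨ *-monoˡ-< _ (*-positive 0<1+ε (^-positive d 0<K)) kb<cn ⟩
        (1ℝ + ε) * fromℕ K ^ⁿ d * (c * n)
          ≡⟨ solve 4 (λ s p c n → s :* p :* (c :* n) := c :* p :* (s :* n)) refl (1ℝ + ε) (fromℕ K ^ⁿ d) c n ⟩
        c * fromℕ K ^ⁿ d * ((1ℝ + ε) * n)
          ≤⟨ *-monoˡ-≤ _ (*-nonneg _ _ 0≤c (^-nonneg d (fromℕ-nonneg K))) large ⟩
        c * fromℕ K ^ⁿ d * (fromℕ (suc K) * α ^ⁿ d)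
          ≡⟨ solve 4 (λ c p N a → c :* p :* (N :* a) := c :* (N :* (a :* p))) refl c (fromℕ K ^ⁿ d) (fromℕ (suc K)) (α ^ⁿ d) ⟩
        c * (fromℕ (suc K) * (α ^ⁿ d * fromℕ K ^ⁿ d))
          ≡⟨ cong (λ p → c * (fromℕ (suc K) * p)) (^-distrib-* α (fromℕ K) d) ⟨
        c * (fromℕ (suc K) * (b * b ^ⁿ e))
          ≡⟨ solve 4 (λ c N b p → c :* (N :* (b :* p)) := b :* (c :* (N :* p))) refl c (fromℕ (suc K)) b (b ^ⁿ e) ⟩
        b * (c * (fromℕ (suc K) * b ^ⁿ e)) ∎)

    Σcost<Σgain : sum cost < sum gain
    Σcost<Σgain = let (c , 0≤c , b≡m+c) = ≤⇒+ m≤b in cost-gap c 0≤c b≡m+c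

    good : Pred (suc K)
    good x = does (m ℕ.≤? deg G x)

    -- Degrees below `m` make `D^e (D - m)` nonpositive, so averaging can be confined to vertices
    -- with room for `W₂`.
    gain≤cost : ∀ x → good x ≡ false → gain x ≤ cost x
    gain≤cost x bad = begin
      D x * D x ^ⁿ e                                             ≤⟨ *-monoʳ-≤ _ (^-nonneg e (fromℕ-nonneg (deg G x)))
                                                                      (fromℕ-mono-≤ (ℕ.<⇒≤ (ℕ.≰⇒> (does-false⁻ (m ℕ.≤? deg G x) bad)))) ⟩
      fromℕ m * D x ^ⁿ e                                         ≡⟨ +-identityˡ _ ⟨
      0ℝ + fromℕ m * D x ^ⁿ e                                    ≤⟨ +-monoˡ-≤ _ (*-nonneg _ _ (proj₁ 0<1+ε)
                                                                      (*-nonneg _ _ (fromℕ-nonneg k) (U-nonneg d _ _))) ⟩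
      (1ℝ + ε) * (fromℕ k * U₀ x) + fromℕ m * D x ^ⁿ e           ∎

    centre : ∃ λ x → m ℕ.≤ deg G x × cost x ≤ gain x
    centre = [ (λ (x , good-x , cost≤gain) → x , does-true⁻ (m ℕ.≤? deg G x) good-x , cost≤gain)
             , (λ (Σgain≤Σcost , _) → ⊥-elim (<⇒≱ Σcost<Σgain Σgain≤Σcost))
             ]′ (pick good cost gain (proj₁ Σcost<Σgain) gain≤cost)

    module FromCentre (x : Fin (suc K)) (m≤deg : m ℕ.≤ deg G x) (cost≤gain : cost x ≤ gain x) where

      r : ℕ
      r = deg G x ∸ m

      deg≡m+r : deg G x ≡ m ℕ.+ r
      deg≡m+r = ≡.sym (ℕ.m+[n∸m]≡n m≤deg)

      deg^≤ : fromℕ (deg G x) ^ⁿ e ≤ (1ℝ + ε) * fromℕ (falling (deg G x) e)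
      deg^≤ = *-cancelˡ-≤ (fromℕ (falling m e)) 0<F (begin
        fromℕ (falling m e) * Δ ^ⁿ e                ≡⟨ trans (*-comm _ _) (cong (_* fromℕ (falling m e)) (≡.sym (fromℕ-^ (deg G x) e))) ⟩
        fromℕ (deg G x ℕ.^ e) * fromℕ (falling m e) ≡⟨ fromℕ-* (deg G x ℕ.^ e) (falling m e) ⟨
        fromℕ (deg G x ℕ.^ e ℕ.* falling m e)       ≤⟨ fromℕ-mono-≤ (falling-ratio e m≤deg) ⟩
        fromℕ (m ℕ.^ e ℕ.* falling (deg G x) e)     ≡⟨ fromℕ-* (m ℕ.^ e) (falling (deg G x) e) ⟩
        fromℕ (m ℕ.^ e) * F                         ≤⟨ *-monoʳ-≤ F (fromℕ-nonneg (falling (deg G x) e)) m^e≤ ⟩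
        (1ℝ + ε) * fromℕ (falling m e) * F          ≡⟨ solve 3 (λ s f F → s :* f :* F := f :* (s :* F)) refl (1ℝ + ε) (fromℕ (falling m e)) F ⟩
        fromℕ (falling m e) * ((1ℝ + ε) * F)        ∎)
        where
        Δ = fromℕ (deg G x)
        F = fromℕ (falling (deg G x) e)
        0<F : 0ℝ < fromℕ (falling m e)
        0<F = fromℕ-positive (falling-positive m e (ℕ.<⇒≤ d≤m))
        m^e≤ : fromℕ (m ℕ.^ e) ≤ (1ℝ + ε) * fromℕ (falling m e)
        m^e≤ = *-cancelˡ-≤ (fromℕ m) 0<fm (begin
          fromℕ m * fromℕ (m ℕ.^ e)                        ≡⟨ fromℕ-* m (m ℕ.^ e) ⟨
          fromℕ (m ℕ.^ d)                                  ≤⟨ m^≤ ⟩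
          (1ℝ + ε) * fromℕ (falling m e ℕ.* (m ∸ e))       ≤⟨ *-monoˡ-≤ _ (proj₁ 0<1+ε) (fromℕ-mono-≤ (ℕ.*-monoʳ-≤ (falling m e) (ℕ.m∸n≤m m e))) ⟩
          (1ℝ + ε) * fromℕ (falling m e ℕ.* m)             ≡⟨ cong ((1ℝ + ε) *_) (fromℕ-* (falling m e) m) ⟩
          (1ℝ + ε) * (fromℕ (falling m e) * fromℕ m)       ≡⟨ solve 3 (λ s f m → s :* (f :* m) := m :* (s :* f)) refl (1ℝ + ε) (fromℕ (falling m e)) (fromℕ m) ⟩
          fromℕ m * ((1ℝ + ε) * fromℕ (falling m e))       ∎)

      kU₀≤ : fromℕ k * U₀ x ≤ fromℕ (suc r ℕ.* falling (deg G x) e)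
      kU₀≤ = *-cancelˡ-≤ (1ℝ + ε) 0<1+ε (begin
        (1ℝ + ε) * (fromℕ k * U₀ x)
          ≤⟨ +-cancelʳ-≤ (fromℕ m * Δ ^ⁿ e) (≤-trans cost≤gain (≤-reflexive split)) ⟩
        fromℕ r * Δ ^ⁿ e
          ≤⟨ *-monoˡ-≤ _ (fromℕ-nonneg r) deg^≤ ⟩
        fromℕ r * ((1ℝ + ε) * F)
          -- The bound with `r` is stronger than needed: the denominator of the weight contains
          -- `suc r`.
          ≤⟨ *-monoʳ-≤ _ (*-nonneg _ _ (proj₁ 0<1+ε) (fromℕ-nonneg (falling (deg G x) e))) (fromℕ-mono-≤ (ℕ.n≤1+n r)) ⟩
        fromℕ (suc r) * ((1ℝ + ε) * F)
          ≡⟨ solve 3 (λ r s f → r :* (s :* f) := s :* (r :* f)) refl (fromℕ (suc r)) (1ℝ + ε) F ⟩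
        (1ℝ + ε) * (fromℕ (suc r) * F)
          ≡⟨ cong ((1ℝ + ε) *_) (fromℕ-* (suc r) (falling (deg G x) e)) ⟨
        (1ℝ + ε) * fromℕ (suc r ℕ.* falling (deg G x) e) ∎)
        where
        Δ = fromℕ (deg G x)
        F = fromℕ (falling (deg G x) e)
        split : Δ * Δ ^ⁿ e ≡ fromℕ r * Δ ^ⁿ e + fromℕ m * Δ ^ⁿ e
        split = trans (cong (λ δ → fromℕ δ * Δ ^ⁿ e) (trans deg≡m+r (ℕ.+-comm m r)))
          (trans (cong (_* Δ ^ⁿ e) (fromℕ-+ r m)) (distribʳ _ _ _))

      -- The numerator `deg + 1 - d = deg - e` of the weight cancels the last factor of
      -- `falling deg d`. This is why `deg^≤` concerns only `e` factors.
      initial : fromℕ k * (weight r (deg G x) d * U₀ x) ≤ 1ℝ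
      initial = begin
        fromℕ k * (fromℕ a * B ⁻¹ * U₀ x)              ≡⟨ solve 4 (λ k a b u → k :* (a :* b :* u) := a :* b :* (k :* u)) refl (fromℕ k) (fromℕ a) (B ⁻¹) (U₀ x) ⟩
        fromℕ a * B ⁻¹ * (fromℕ k * U₀ x)              ≤⟨ *-monoˡ-≤ _ (weight-nonneg r (deg G x) d) kU₀≤ ⟩
        fromℕ a * B ⁻¹ * fromℕ (suc r ℕ.* falling (deg G x) e)
          ≡⟨ solve 3 (λ a b c → a :* b :* c := c :* a :* b) refl (fromℕ a) (B ⁻¹) (fromℕ (suc r ℕ.* falling (deg G x) e)) ⟩
        fromℕ (suc r ℕ.* falling (deg G x) e) * fromℕ a * B ⁻¹
          ≡⟨ cong (_* B ⁻¹) (trans (≡.sym (fromℕ-* (suc r ℕ.* falling (deg G x) e) a)) (cong fromℕ (ℕ.*-assoc (suc r) (falling (deg G x) e) a))) ⟩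
        B * B ⁻¹                                       ≡⟨ *-inverseʳ (fromℕ-positive (weight-denominator r (ℕ.≤-trans d≤m m≤deg))) ⟩
        1ℝ                                             ∎
        where
        a = deg G x ∸ e
        B = fromℕ (suc r ℕ.* falling (deg G x) d)

      placement : (S : Fin k → Pred m) → (∀ w → count (S w) ≡ d) → Placement S (E x) (λ _ _ → true) x
      placement S |S| = place m r S (E x) (λ _ _ → true) x deg≡m+r (λ _ → refl)
        (λ v xv → trans (Graph.sym G v x) xv) (begin
          sum (λ w → weight r (m ℕ.+ r) (count (S w)) * U (E x) (λ _ → true) (count (S w)))
            ≡⟨ sum-cong-≗ (λ w → cong₂ (λ δ t → weight r δ t * U (E x) (λ _ → true) t) (≡.sym deg≡m+r) (|S| w)) ⟩
          sum {k} (λ w → weight r (deg G x) d * U₀ x)   ≡⟨ sum-const k _ ⟩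
          fromℕ k * (weight r (deg G x) d * U₀ x)       ≤⟨ initial ⟩
          1ℝ ∎)

-- Joining the embeddings of `W₂` and `W₁`.

module Assembly (R : RealField) {n N : ℕ} (G : Graph N) (H : Graph n) (side : Pred n)
  (independent : IndependentBipartition H side)
  (d : ℕ) (degree≤d : W₁-degree≤ H side d) (d≤m : d ℕ.≤ sizeW₂ side) where
  open OrderedField R
  open Potential R G

  private
    m = sizeW₂ side
    k = count (not ∘ side)
    module W₂ = Enumeration (enumerate side)
    module W₁ = Enumeration (enumerate (not ∘ side))

  not-true⁻ : ∀ {b} → not b ≡ true → b ≡ false
  not-true⁻ {false} _ = refl

  neighbours : Fin k → Pred m
  neighbours w a = adj H (W₁.elem w) (W₂.elem a)

  neighbourhood : ∀ w → ∃ λ q → count q ≡ d × (∀ a → neighbours w a ≡ true → q a ≡ true)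
  neighbourhood w = extend (neighbours w) d
    (subst (ℕ._≤ d) (≡.sym (W₂.count-elem (adj H (W₁.elem w))))
      (degree≤d (W₁.elem w) (not-true⁻ (W₁.elem-in w)))) d≤m

  S : Fin k → Pred m
  S w = proj₁ (neighbourhood w)

  |S| : ∀ w → count (S w) ≡ d
  |S| w = proj₁ (proj₂ (neighbourhood w))

  assemble : ∀ {A x} → Placement S A (λ _ _ → true) x → H ⊆G G
  assemble {A} {x} P with distinct-representatives k Q′ (λ w → count-positive (Q′ w) x (Q′-x w)) Q′-sum
    where open Placement P
  ... | ψ , ψ-injective , Q′ψ = f , f-injective , f-adjacent
    where
    open Placement P
    -- The side is passed as an argument with its equation, so that the proofs below can split on it
    -- directly.
    place-by : ∀ i b → side i ≡ b → Fin N
    place-by i true  s = φ (W₂.rank i s)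
    place-by i false s = ψ (W₁.rank i (cong not s))
    f : Fin n → Fin N
    f i = place-by i (side i) refl
    place-injective : ∀ i j b c (s : side i ≡ b) (t : side j ≡ c) → place-by i b s ≡ place-by j c t → i ≡ j
    place-injective i j true  true  s t eq = W₂.rank-injective s t (φ-injective eq)
    place-injective i j false false s t eq = W₁.rank-injective _ _ (ψ-injective eq)
    place-injective i j true  false s t eq = ⊥-elim (Q′-avoids _ _ _ (Q′ψ _) eq)
    place-injective i j false true  s t eq = ⊥-elim (Q′-avoids _ _ _ (Q′ψ _) (≡.sym eq))
    f-injective : Injective _≡_ _≡_ f
    f-injective {i} {j} = place-injective i j _ _ refl refl
    cross : ∀ i j (s : side i ≡ false) (t : side j ≡ true) → adj H i j ≡ true →
            adj G (φ (W₂.rank j t)) (ψ (W₁.rank i (cong not s))) ≡ true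
    cross i j s t ij = Q′-adjacent w _ a (proj₂ (proj₂ (neighbourhood w)) a
      (trans (cong₂ (adj H) (W₁.elem-rank i (cong not s)) (W₂.elem-rank j t)) ij)) (Q′ψ w)
      where
      w = W₁.rank i (cong not s)
      a = W₂.rank j t
    place-adjacent : ∀ i j b c (s : side i ≡ b) (t : side j ≡ c) → adj H i j ≡ true →
                     adj G (place-by i b s) (place-by j c t) ≡ true
    place-adjacent i j true  true  s t ij = ⊥-elim (independent i j ij (trans s (≡.sym t)))
    place-adjacent i j false false s t ij = ⊥-elim (independent i j ij (trans s (≡.sym t)))
    place-adjacent i j true  false s t ij = cross j i t s (trans (Graph.sym H j i) ij)
    place-adjacent i j false true  s t ij = trans (Graph.sym G _ _) (cross i j s t ij)
    f-adjacent : ∀ i j → adj H i j ≡ true → adj G (f i) (f j) ≡ true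
    f-adjacent i j = place-adjacent i j _ _ refl refl

open import Data.Integer as ℤ using (+_)

theorem1p3 : (R : RealField) → let open RealField R in
    (d : ℕ) (α ε : ℝ) → 0ℝ < α → 0ℝ < ε →
    α ^ᶻ ((+ d) ℤ.* ((+ d) ℤ.- (+ 2))) ≤ ε → ε < 1ℝ →
    (n N : ℕ) → (1ℝ + ε) * (α ^ᶻ (ℤ.- (+ d))) * fromℕ n ≤ fromℕ N →
    (G : Graph N) → α ≤ density R G →
    (H : Graph n) → InFamily R d ε H → H ⊆G G
-- For `d = 0, 1, 2` the exponent `d(d-2)` is `0, -1, 0`, so the power of `α` is at least 1 and
-- exceeds `ε`.
theorem1p3 R zero α ε 0<α 0<ε α^≤ε ε<1 n N large G dense H _ =
  ⊥-elim (<⇒≱ ε<1 α^≤ε)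
  where open OrderedField R
theorem1p3 R (suc zero) α ε 0<α 0<ε α^≤ε ε<1 n N large G dense H _ =
  ⊥-elim (<⇒≱ ε<1 (≤-trans 1≤α⁻¹ α^≤ε))
  where
  open OrderedField R
  open DensityBounds R G
  0<α^1 : 0ℝ < α ^ⁿ 1
  0<α^1 = ^-positive 1 0<α
  1≤α⁻¹ : 1ℝ ≤ (α ^ⁿ 1) ⁻¹
  1≤α⁻¹ = *-cancelˡ-≤ (α ^ⁿ 1) 0<α^1
    (subst₂ _≤_ (≡.sym (*-identityʳ _)) (≡.sym (*-inverseʳ 0<α^1)) (^≤1 1 (proj₁ 0<α) (α≤1 α 0<α dense)))
theorem1p3 R (suc (suc zero)) α ε 0<α 0<ε α^≤ε ε<1 n N large G dense H _ =
  ⊥-elim (<⇒≱ ε<1 α^≤ε)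
  where open OrderedField R
theorem1p3 R (suc (suc (suc j))) α ε 0<α 0<ε α^≤ε ε<1 n zero large G dense H _ =
  ⊥-elim (ℕ.<⇒≢ (DensityBounds.pairs-positive R G α 0<α dense) refl)
theorem1p3 R (suc (suc (suc j))) α ε 0<α 0<ε α^≤ε ε<1 n (suc K) large G dense H
  (side , independent , degree≤d , d≤m , ratio) = assemble
  (let (x , m≤deg , cost≤gain) = centre in FromCentre.placement x m≤deg cost≤gain S |S|)
  where
  open OrderedField R
  open Assembly R G H side independent (3 ℕ.+ j) degree≤d d≤m
  k+m≡n : count (not ∘ side) ℕ.+ sizeW₂ side ≡ n
  k+m≡n = trans (ℕ.+-comm (count (not ∘ side)) _) (count-not side)
  p : ℝ
  p = α ^ⁿ (3 ℕ.+ j)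
  0<p : 0ℝ < p
  0<p = ^-positive (3 ℕ.+ j) 0<α
  large′ : (1ℝ + ε) * fromℕ (count (not ∘ side) ℕ.+ sizeW₂ side) ≤ fromℕ (suc K) * p
  large′ = begin
    (1ℝ + ε) * fromℕ (count (not ∘ side) ℕ.+ sizeW₂ side)  ≡⟨ cong (λ c → (1ℝ + ε) * fromℕ c) k+m≡n ⟩
    (1ℝ + ε) * fromℕ n                                     ≡⟨ *-identityʳ _ ⟨
    (1ℝ + ε) * fromℕ n * 1ℝ                                ≡⟨ cong ((1ℝ + ε) * fromℕ n *_) (*-inverseˡ 0<p) ⟨
    (1ℝ + ε) * fromℕ n * (p ⁻¹ * p)                        ≡⟨ solve 4 (λ s n q p → s :* n :* (q :* p) := s :* q :* n :* p) refl (1ℝ + ε) (fromℕ n) (p ⁻¹) p ⟩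
    (1ℝ + ε) * p ⁻¹ * fromℕ n * p                          ≤⟨ *-monoʳ-≤ p (proj₁ 0<p) large ⟩
    fromℕ (suc K) * p                                      ∎
    where open ≤-Reasoning
  open Centre R G α ε 0<α 0<ε dense (2 ℕ.+ j)
    (count (not ∘ side)) (sizeW₂ side) (ℕ.s≤s (ℕ.s≤s ℕ.z≤n)) d≤m large′ ratio using (centre; module FromCentre)
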